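{- For $\mathbf k=(k_1,\dots,k_d)\in\mathbb Z_{\ge0}^d$, \begin{align*} \Delta_a(v_{k_1}\cdots v_{k_d})=\sum_{\substack{0\le n\le d\\0\le i_1<j_1\le i_2<j_2\le\cdots\le i_n<j_n\le d}}\ \sum_{\mathbf l_1,\dots,\mathbf l_n}\ \prod_{s=1}^n\mathrm m_{\widehat{\mathbf k_s}^{j_s}+\mathbf l_s,\widehat{\mathbf k_s}^{j_s}}\ \Big(&v_{k_1}\cdots v_{k_{i_1}}⧢\mathop{⧢}_{s=1}^n\big(S(v_{k_{i_s+1}+l_{i_s+1}}\cdots v_{k_{j_s-1}+l_{j_s-1}})⧢v_{k_{j_s+1}+l_{j_s+1}}\cdots v_{k_{i_{s+1}}+l_{i_{s+1}}}\big)\Big)\\ &\otimes v_{k_{j_1}-|\mathbf l_1|}\cdots v_{k_{j_n}-|\mathbf l_n|}, \end{align*} where $i_{n+1}=d$, $\mathbf k_s=(k_{i_s+1},\dots,k_{i_{s+1}})$, $\widehat{\mathbf k_s}^{j_s}$ is $\mathbf k_s$ with the entry $k_{j_s}$ removed, and $\mathbf l_s=(l_{i_s+1},\dots,\widehat{l_{j_s}},\dots,l_{i_{s+1}})\in\mathbb Z_{\ge0}^{i_{s+1}-i_s-1}$ runs over tuples with $\mathbf l_s=\emptyset$ or $|\mathbf l_s|\le k_{j_s}-1$.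
   Context: $V=\{v_0,v_1,\dots\}$ with weight $\mathrm{wt}(v_0)=1$, $\mathrm{wt}(v_i)=i$. Ari multiplicity $\mathrm m_{\mathbf k,\mathbf l}=(-1)^{|\mathbf k|+|\mathbf l|}\prod_i\binom{k_i-1}{l_i-1}$ ($|\cdot|$ = sum of entries) with $\binom{ -1}{ -1}=1$, $\binom{k-1}{ -1}=\binom{ -1}{l-1}=0$ for $k,l>0$, usual binomials otherwise, $\mathrm m_{\emptyset,\emptyset}=1$. $\mathbb Q\langle V\rangle$: free associative algebra $=U(\mathrm{Lie}(V))$, shuffle coproduct $\Delta$ (letters primitive, Sweedler notation), antipode $S(a_1\cdots a_n)=(-1)^na_n\cdots a_1$, shuffle product $⧢$; empty products are $\mathbf1$. $\triangleright_a$ is the post-Lie product on the free Lie algebra $\mathrm{Lie}(V)$ obtained from the free magma $M(V)$ (product $\star$): for a bracketing $t(\mathbf k)$ of letters $v_{k_1},\dots,v_{k_r}$, $t(\mathbf k)\triangleright_av_0=0$ and $t(\mathbf k)\triangleright_av_s=\sum_{\mathbf l}\mathrm m_{\mathbf k,\mathbf l}v_{s+|\mathbf k|-|\mathbf l|}\star t(\mathbf l)$ for $s\ge1$ ($t(\mathbf l)$ the same bracketing of $v_{l_1},\dots,v_{l_r}$), extended linearly in $t$, as a derivation in the second argument, and descended via $a\star b\mapsto[a,b]$. It extends to $\mathbb Q\langle V\rangle^{\otimes2}$ by $x\triangleright\mathbf1=0$, $\mathbf1\triangleright A=A$, $xA\triangleright y=x\triangleright(A\triangleright y)-(x\triangleright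 A)\triangleright y$, $A\triangleright BC=(A_{(1)}\triangleright B)(A_{(2)}\triangleright C)$; the Grossman–Larson product is $A\circledast_aB=A_{(1)}(A_{(2)}\triangleright_aB)$, and $\Delta_a$ is defined by $(A\circledast_aB\mid C)=(A\otimes B\mid\Delta_a(C))$ for the pairing making words orthonormal. -}

module Defs where

open import Data.Nat using (ℕ; zero; suc; _+_; _∸_; _≤ᵇ_)
open import Data.Nat.Combinatorics using (_C_)
open import Data.Integer using (+_)
open import Data.Rational using (ℚ; 0ℚ; 1ℚ; _/_; -_) renaming (_+_ to _+q_; _*_ to _*q_)
open import Data.List using (List; []; _∷_; _++_; map; concatMap; concat; reverse; length; zipWith; take; drop; upTo; foldr)
open import Data.Nat.ListAction using (sum)
import Data.List.Properties as LP
open import Data.Vec using (Vec; []; _∷_; fromList)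
open import Data.Product using (_×_; _,_; proj₁; proj₂)
import Data.Product.Properties as PP
open import Data.Bool using (if_then_else_)
import Data.Nat as N
open import Relation.Nullary using (yes; no)
open import Relation.Binary.PropositionalEquality using (_≡_)

-- Formal ℚ-linear combinations.  An element of ℚ⟨V⟩ is a
-- Lin (List ℕ): the word [k₁,…,k_d] stands for v_{k₁}⋯v_{k_d}.
-- Elements are compared through their coefficients (`coeff`).

Lin : Set → Set
Lin X = List (ℚ × X)

sgn : ℕ → ℚ
sgn zero    = 1ℚ
sgn (suc n) = - sgn n

fromℕq : ℕ → ℚ
fromℕq n = (+ n) / 1

scaleL : {X : Set} → ℚ → Lin X → Lin X
scaleL c = map (λ p → c *q proj₁ p , proj₂ p)

negL : {X : Set} → Lin X → Lin X
negL = scaleL (- 1ℚ)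

mapL : {X Y : Set} → (X → Y) → Lin X → Lin Y
mapL f = map (λ p → proj₁ p , f (proj₂ p))

bindL : {X Y : Set} → Lin X → (X → Lin Y) → Lin Y
bindL xs f = concatMap (λ p → scaleL (proj₁ p) (f (proj₂ p))) xs

mulL : Lin (List ℕ) → Lin (List ℕ) → Lin (List ℕ)
mulL a b = bindL a (λ u → bindL b (λ w → (1ℚ , u ++ w) ∷ []))

coeff : Lin (List ℕ) → List ℕ → ℚ
coeff [] w = 0ℚ
coeff ((c , u) ∷ xs) w with LP.≡-dec N._≟_ u w
... | yes _ = c +q coeff xs w
... | no  _ = coeff xs w

coeff2 : Lin (List ℕ × List ℕ) → List ℕ × List ℕ → ℚ
coeff2 [] w = 0ℚ
coeff2 ((c , u) ∷ xs) w with PP.≡-dec (LP.≡-dec N._≟_) (LP.≡-dec N._≟_) u w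
... | yes _ = c +q coeff2 xs w
... | no  _ = coeff2 xs w

sh : List ℕ → List ℕ → Lin (List ℕ)
sh [] w = (1ℚ , w) ∷ []
sh (x ∷ v) [] = (1ℚ , x ∷ v) ∷ []
sh (x ∷ v) (y ∷ w) = mapL (x ∷_) (sh v (y ∷ w)) ++ mapL (y ∷_) (sh (x ∷ v) w)

shL : Lin (List ℕ) → Lin (List ℕ) → Lin (List ℕ)
shL a b = bindL a (λ u → bindL b (λ w → sh u w))

-- Δ(w) = Σ w₍₁₎ ⊗ w₍₂₎ (deshuffles, with multiplicity)
desh : List ℕ → List (List ℕ × List ℕ)
desh [] = ([] , []) ∷ []
desh (x ∷ w) = concatMap (λ p → (x ∷ proj₁ p , proj₂ p) ∷ (proj₁ p , x ∷ proj₂ p) ∷ []) (desh w)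

antipode : List ℕ → Lin (List ℕ)
antipode w = (sgn (length w) , reverse w) ∷ []

-- Ari multiplicity  m_{k,l} = (-1)^{|k|+|l|} Π binom(k_i - 1, l_i - 1)
-- bnm k l = binom(k-1, l-1) with the stated conventions.

bnm : ℕ → ℕ → ℚ
bnm zero zero = 1ℚ
bnm zero (suc l) = 0ℚ
bnm (suc k) zero = 0ℚ
bnm (suc k) (suc l) = fromℕq (k C l)

-- (only applied to lists of equal length; m_{∅,∅} = 1)
mult : List ℕ → List ℕ → ℚ
mult k l = sgn (sum k + sum l) *q foldr _*q_ 1ℚ (zipWith bnm k l)

data Tree : Set where
  leaf : ℕ → Tree
  node : Tree → Tree → Tree

leaves : Tree → List ℕ
leaves (leaf k) = k ∷ []
leaves (node a b) = leaves a ++ leaves b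

relabelS : Tree → List ℕ → Tree × List ℕ
relabelS (leaf k) [] = leaf k , []
relabelS (leaf k) (l ∷ ls) = leaf l , ls
relabelS (node a b) ls with relabelS a ls
... | a' , ls' with relabelS b ls'
... | b' , ls'' = node a' b' , ls''

relabel : Tree → List ℕ → Tree
relabel t l = proj₁ (relabelS t l)

-- all l with 0 ≤ l_i ≤ k_i (m_{k,l} = 0 outside this box)
boxes : List ℕ → List (List ℕ)
boxes [] = [] ∷ []
boxes (k ∷ ks) = concatMap (λ a → map (a ∷_) (boxes ks)) (upTo (suc k))

mag : Tree → Tree → Lin Tree
mag t (leaf zero) = []
mag t (leaf (suc s)) =
  map (λ l → mult (leaves t) l , node (leaf (suc s + sum (leaves t) ∸ sum l)) (relabel t l))
      (boxes (leaves t))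
mag t (node a b) = mapL (λ a' → node a' b) (mag t a) ++ mapL (node a) (mag t b)

-- image of a magma element in Lie(V) ⊂ ℚ⟨V⟩ (a ⋆ b ↦ [a,b])
expT : Tree → Lin (List ℕ)
expT (leaf k) = (1ℚ , k ∷ []) ∷ []
expT (node a b) = mulL (expT a) (expT b) ++ negL (mulL (expT b) (expT a))

-- x ▷ (t₁⋯tₙ) for x ∈ Lie(V): derivation on a product of Lie elements
derVec : {n : ℕ} → Tree → Vec Tree n → Lin (Vec Tree n)
derVec t [] = []
derVec t (u ∷ A) = mapL (_∷ A) (mag t u) ++ mapL (u ∷_) (derVec t A)

-- (t₁⋯tₙ) ▷ y ∈ Lie(V) for t_i, y ∈ Lie(V), via
--   1 ▷ y = y,   xA ▷ y = x ▷ (A ▷ y) − (x ▷ A) ▷ y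
act : {n : ℕ} → Vec Tree n → Tree → Lin Tree
act [] y = (1ℚ , y) ∷ []
act (t ∷ A) y = bindL (act A y) (mag t) ++ negL (bindL (derVec t A) (λ A' → act A' y))

-- A ▷_a B for words A, B, via A ▷ 1 = ε(A), A ▷ bB = (A₍₁₎ ▷ b)(A₍₂₎ ▷ B)
triW : List ℕ → List ℕ → Lin (List ℕ)
triW [] [] = (1ℚ , []) ∷ []
triW (_ ∷ _) [] = []
triW A (b ∷ B) =
  concatMap (λ p → mulL (bindL (act (fromList (map leaf (proj₁ p))) (leaf b)) expT)
                        (triW (proj₂ p) B))
            (desh A)

gl : List ℕ → List ℕ → Lin (List ℕ)
gl A B = concatMap (λ p → mulL ((1ℚ , proj₁ p) ∷ []) (triW (proj₂ p) B)) (desh A)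

-- coefficient of u ⊗ w in Δ_a(C):  (u ⊛_a w | C)
Δa-coeff : List ℕ → List ℕ → List ℕ → ℚ
Δa-coeff C u w = coeff (gl u w) C

prefixes : List ℕ → List (List ℕ × List ℕ)
prefixes [] = ([] , []) ∷ []
prefixes (x ∷ xs) = ([] , x ∷ xs) ∷ map (λ p → x ∷ proj₁ p , proj₂ p) (prefixes xs)

-- a block (k_{i_s+1},…,k_{j_s-1}) , k_{j_s} , (k_{j_s+1},…,k_{i_{s+1}})
Block : Set
Block = List ℕ × ℕ × List ℕ

-- all decompositions of a list into consecutive nonempty blocks, each
-- with a marked entry (i.e. choices i_s < j_s ≤ i_{s+1} with i_1 = 0,
-- i_{n+1} = length)
goBefore : List ℕ → List ℕ → List (List Block)
goAfter  : List ℕ → ℕ → List ℕ → List ℕ → List (List Block)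
goBefore b [] = []
goBefore b (x ∷ xs) = goBefore (b ++ x ∷ []) xs ++ goAfter b x [] xs
goAfter b c a [] = ((b , c , a) ∷ []) ∷ []
goAfter b c a (x ∷ xs) =
  goAfter b c (a ++ x ∷ []) xs ++
  map ((b , c , a) ∷_) (goBefore (x ∷ []) xs ++ goAfter [] x [] xs)

markedBlocks : List ℕ → List (List Block)
markedBlocks [] = [] ∷ []
markedBlocks (x ∷ xs) = goBefore [] (x ∷ xs)

bnd : ℕ → ℕ → List (List ℕ)
bnd zero N = [] ∷ []
bnd (suc r) N = concatMap (λ a → map (a ∷_) (bnd r (N ∸ a))) (upTo (suc N))

lsFor : Block → List (List ℕ)
lsFor (b , c , a) with length b + length a
... | zero = [] ∷ []
... | suc r with c
...   | zero = []
...   | suc c' = bnd (suc r) c'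

blockCoef : Block → List ℕ → ℚ
blockCoef (b , c , a) l = mult (zipWith _+_ (b ++ a) l) (b ++ a)

blockLeft : Block → List ℕ → Lin (List ℕ)
blockLeft (b , c , a) l =
  shL (antipode (zipWith _+_ b (take (length b) l)))
      ((1ℚ , zipWith _+_ a (drop (length b) l)) ∷ [])

blockRight : Block → List ℕ → ℕ
blockRight (b , c , a) l = c ∸ sum l

blocksRHS : List Block → Lin (List ℕ × List ℕ)
blocksRHS [] = (1ℚ , [] , []) ∷ []
blocksRHS (β ∷ βs) =
  concatMap (λ l →
    scaleL (blockCoef β l)
      (bindL (blockLeft β l) (λ u →
        bindL (blocksRHS βs) (λ p →
          mapL (λ w → w , blockRight β l ∷ proj₂ p) (sh u (proj₁ p))))))
    (lsFor β)

ariRHS : List ℕ → Lin (List ℕ × List ℕ)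
ariRHS k =
  concatMap (λ pr →
    concatMap (λ βs →
      bindL (blocksRHS βs) (λ p →
        mapL (λ w → w , proj₂ p) (sh (proj₁ pr) (proj₁ p))))
      (markedBlocks (proj₂ pr)))
    (prefixes k)

{-# OPTIONS --safe #-}
-- Let Φ(v_k) = Σ_l m_{k,l} v_l, the drop k − l being recorded by a power of T.
-- With v_k ↔ x^{k−1} one has m_{k,l} = coefficient of T^{k−l} x^{l−1} in
-- (x − T)^{k−1}, so Φ is the translation x ↦ x − T, while v_k ▷ v_w is
-- y^{w−1}(x − y)^{k−1}, in which x − y is translation invariant.  Hence Φ
-- commutes with the derivations t ▷ ─, already in the free magma, and by
-- induction on the word u one gets, with y ⋆ (t₁, …, tᵣ) = (⋯(y ⋆ t₁)⋯) ⋆ tᵣ,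
--   u ▷ v_s = Σ_l m_{u,l} v_{s+|u|−|l|} ⋆ l        (s ≥ 1).
-- In ℚ⟨V⟩ the right-hand side is Σ S(l₍₁₎) v_{s+|u|−|l|} l₍₂₎, and its
-- transpose is the contribution of one block.  The sum over all blocks arises
-- because u ▷ b₁⋯bₙ = ∏ (u₍ᵢ₎ ▷ bᵢ), as ⧢ is dual to Δ.  Linear
-- combinations are compared by evaluating linear functionals on them.
module Submission where

open import Defs
open import Data.Nat as ℕ using (ℕ; zero; suc; _∸_; _≤_; _<_; z≤n; s≤s) renaming (_+_ to _+ⁿ_)
import Data.Nat.Properties as ℕP
open import Data.Nat.Combinatorics using (_C_; nCk+nC[k+1]≡[n+1]C[k+1]; k>n⇒nCk≡0)
open import Data.Nat.ListAction using (sum)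
open import Data.Rational using (ℚ; 0ℚ; 1ℚ; _+_; _*_; _-_; -_)
open import Data.Rational.Properties hiding (_≟_)
import Data.Integer as ℤ
import Data.Integer.Properties as ℤP
import Data.Rational.Unnormalised as ℚᵘ
import Data.Rational.Unnormalised.Properties as ℚᵘP
open import Data.Rational.Solver using (module +-*-Solver)
open import Data.List using (List; []; _∷_; _++_; _ʳ++_; map; concatMap; reverse; length; zipWith; take; drop; upTo; applyUpTo; foldr; foldl)
import Data.List.Properties as LP
open import Data.Vec using (Vec; []; _∷_; fromList; toList)
open import Data.Product using (_×_; _,_; proj₁; proj₂)
import Data.Product.Properties as PP
open import Data.Empty using (⊥-elim)
open import Function using (_∘_)
open import Relation.Nullary using (yes; no)
open import Relation.Binary.PropositionalEquality
open ≡-Reasoning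
open +-*-Solver using (solve; _:=_; _:+_; _:*_; :-_; con)

-- Evaluation of linear functionals

-- A `Lin` is a list of terms, so different lists can represent the same element. Identities are
-- therefore stated as equalities of evaluations `∑ L f`, mostly for arbitrary `f`. This also lets
-- one summation be absorbed into the functional of another. The drop is carried as a number beside
-- every lowered object. The index of a letter created by an action depends on the labels only
-- through the total drop, and drops add, whereas `mag` expresses them by truncated differences. The
-- lowering has two descriptions: a recursive one, where translation invariance is visible, and one
-- by Ari multiplicities, which meets `mag` and the final formula. The letter v_0 lies outside the
-- dictionary with powers of x: it is fixed by the lowering, with drop 0, and is treated separately
-- throughout. Transposition reverses the point of view. The action lowers an unknown source to a
-- given word; the coproduct is given the lowered word k̂ and sums over the sources k̂ + l, whence
-- the multiplicities m with indices k̂ + l and k̂.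

⟪_⟫ : {X : Set} → List X → Lin X
⟪_⟫ = map (1ℚ ,_)

private
  variable
    X Y : Set

opaque
  -- Opaque so that `∑ L f` never unfolds: the blanks in the equational chains are then found by
  -- comparing `L` and `f` alone.
  ∑ : {X : Set} → Lin X → (X → ℚ) → ℚ
  ∑ [] f = 0ℚ
  ∑ ((c , x) ∷ L) f = c * f x + ∑ L f

opaque
  unfolding ∑

  ∑-∷ : (c : ℚ) (x : X) (L : Lin X) (f : X → ℚ) → ∑ ((c , x) ∷ L) f ≡ c * f x + ∑ L f
  ∑-∷ c x L f = refl

  ∑-[] : (f : X → ℚ) → ∑ [] f ≡ 0ℚ
  ∑-[] f = refl

  ∑-cong : (L : Lin X) {f g : X → ℚ} → (∀ x → f x ≡ g x) → ∑ L f ≡ ∑ L g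
  ∑-cong [] h = refl
  ∑-cong ((c , x) ∷ L) h = cong₂ (λ a b → c * a + b) (h x) (∑-cong L h)

  ∑-congˡ : {L M : Lin X} {f : X → ℚ} → L ≡ M → ∑ L f ≡ ∑ M f
  ∑-congˡ {f = f} = cong (λ L → ∑ L f)

  ∑-++ : (L M : Lin X) (f : X → ℚ) → ∑ (L ++ M) f ≡ ∑ L f + ∑ M f
  ∑-++ [] M f = sym (+-identityˡ _)
  ∑-++ ((c , x) ∷ L) M f = trans (cong ((c * f x) +_) (∑-++ L M f)) (sym (+-assoc (c * f x) (∑ L f) (∑ M f)))

  ∑-scaleL : (c : ℚ) (L : Lin X) (f : X → ℚ) → ∑ (scaleL c L) f ≡ c * ∑ L f
  ∑-scaleL c [] f = sym (*-zeroʳ c)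
  ∑-scaleL c ((b , x) ∷ L) f = trans (cong ((c * b * f x) +_) (∑-scaleL c L f))
    (solve 4 (λ c b y r → c :* b :* y :+ c :* r := c :* (b :* y :+ r)) refl c b (f x) (∑ L f))

  ∑-negL : (L : Lin X) (f : X → ℚ) → ∑ (negL L) f ≡ - ∑ L f
  ∑-negL L f = trans (∑-scaleL (- 1ℚ) L f) (solve 1 (λ x → :- con 1ℚ :* x := :- x) refl (∑ L f))

  ∑-mapL : (h : X → Y) (L : Lin X) (f : Y → ℚ) → ∑ (mapL h L) f ≡ ∑ L (f ∘ h)
  ∑-mapL h [] f = refl
  ∑-mapL h ((c , x) ∷ L) f = cong ((c * f (h x)) +_) (∑-mapL h L f)

  ∑-bindL : (L : Lin X) (h : X → Lin Y) (f : Y → ℚ) → ∑ (bindL L h) f ≡ ∑ L (λ x → ∑ (h x) f)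
  ∑-bindL [] h f = refl
  ∑-bindL ((c , x) ∷ L) h f = trans (∑-++ (scaleL c (h x)) (bindL L h) f)
    (cong₂ _+_ (∑-scaleL c (h x) f) (∑-bindL L h f))

  ∑-concatMap : (h : X → Lin Y) (xs : List X) (f : Y → ℚ) → ∑ (concatMap h xs) f ≡ ∑ ⟪ xs ⟫ (λ x → ∑ (h x) f)
  ∑-concatMap h [] f = refl
  ∑-concatMap h (x ∷ xs) f = trans (∑-++ (h x) (concatMap h xs) f)
    (cong₂ _+_ (sym (*-identityˡ (∑ (h x) f))) (∑-concatMap h xs f))

  ∑-single : (x : X) (f : X → ℚ) → ∑ ((1ℚ , x) ∷ []) f ≡ f x
  ∑-single x f = trans (+-identityʳ (1ℚ * f x)) (*-identityˡ (f x))

  ∑-⟪∷⟫ : (x : X) (xs : List X) (f : X → ℚ) → ∑ ⟪ x ∷ xs ⟫ f ≡ f x + ∑ ⟪ xs ⟫ f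
  ∑-⟪∷⟫ x xs f = cong (_+ ∑ ⟪ xs ⟫ f) (*-identityˡ (f x))

  ∑-⟪++⟫ : (xs ys : List X) (f : X → ℚ) → ∑ ⟪ xs ++ ys ⟫ f ≡ ∑ ⟪ xs ⟫ f + ∑ ⟪ ys ⟫ f
  ∑-⟪++⟫ xs ys f = trans (cong (λ l → ∑ l f) (LP.map-++ (1ℚ ,_) xs ys)) (∑-++ ⟪ xs ⟫ ⟪ ys ⟫ f)

  ∑-⟪map⟫ : (h : X → Y) (xs : List X) (f : Y → ℚ) → ∑ ⟪ map h xs ⟫ f ≡ ∑ ⟪ xs ⟫ (f ∘ h)
  ∑-⟪map⟫ h [] f = refl
  ∑-⟪map⟫ h (x ∷ xs) f = cong ((1ℚ * f (h x)) +_) (∑-⟪map⟫ h xs f)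

  ∑-⟪concatMap⟫ : (h : X → List Y) (xs : List X) (f : Y → ℚ) →
    ∑ ⟪ concatMap h xs ⟫ f ≡ ∑ ⟪ xs ⟫ (λ x → ∑ ⟪ h x ⟫ f)
  ∑-⟪concatMap⟫ h [] f = refl
  ∑-⟪concatMap⟫ h (x ∷ xs) f = trans (∑-⟪++⟫ (h x) (concatMap h xs) f)
    (trans (cong (∑ ⟪ h x ⟫ f +_) (∑-⟪concatMap⟫ h xs f)) (sym (∑-⟪∷⟫ x xs (λ x → ∑ ⟪ h x ⟫ f))))

  ∑-mapCoef : (m : X → ℚ) (h : X → Y) (xs : List X) (f : Y → ℚ) →
    ∑ (map (λ x → m x , h x) xs) f ≡ ∑ ⟪ xs ⟫ (λ x → m x * f (h x))
  ∑-mapCoef m h [] f = refl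
  ∑-mapCoef m h (x ∷ xs) f = cong₂ _+_ (sym (*-identityˡ (m x * f (h x)))) (∑-mapCoef m h xs f)

  ∑-0 : (L : Lin X) → ∑ L (λ _ → 0ℚ) ≡ 0ℚ
  ∑-0 [] = refl
  ∑-0 ((c , x) ∷ L) = trans (cong₂ _+_ (*-zeroʳ c) (∑-0 L)) (+-identityˡ 0ℚ)

  ∑-zero : (L : Lin X) {f : X → ℚ} → (∀ x → f x ≡ 0ℚ) → ∑ L f ≡ 0ℚ
  ∑-zero L h = trans (∑-cong L h) (∑-0 L)

  ∑-+ : (L : Lin X) (f g : X → ℚ) → ∑ L (λ x → f x + g x) ≡ ∑ L f + ∑ L g
  ∑-+ [] f g = sym (+-identityˡ 0ℚ)
  ∑-+ ((c , x) ∷ L) f g = trans (cong ((c * (f x + g x)) +_) (∑-+ L f g))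
    (solve 5 (λ c a b r s → c :* (a :+ b) :+ (r :+ s) := (c :* a :+ r) :+ (c :* b :+ s)) refl c (f x) (g x) (∑ L f) (∑ L g))

  ∑-*ˡ : (L : Lin X) (a : ℚ) (f : X → ℚ) → ∑ L (λ x → a * f x) ≡ a * ∑ L f
  ∑-*ˡ [] a f = sym (*-zeroʳ a)
  ∑-*ˡ ((c , x) ∷ L) a f = trans (cong ((c * (a * f x)) +_) (∑-*ˡ L a f))
    (solve 4 (λ c a y r → c :* (a :* y) :+ a :* r := a :* (c :* y :+ r)) refl c a (f x) (∑ L f))

  ∑-*ʳ : (L : Lin X) (a : ℚ) (f : X → ℚ) → ∑ L (λ x → f x * a) ≡ ∑ L f * a
  ∑-*ʳ L a f = trans (∑-cong L (λ x → *-comm (f x) a)) (trans (∑-*ˡ L a f) (*-comm a (∑ L f)))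

  ∑-neg : (L : Lin X) (f : X → ℚ) → ∑ L (λ x → - f x) ≡ - ∑ L f
  ∑-neg L f = trans (∑-cong L (λ x → solve 1 (λ y → :- y := :- con 1ℚ :* y) refl (f x)))
    (trans (∑-*ˡ L (- 1ℚ) f) (solve 1 (λ y → :- con 1ℚ :* y := :- y) refl (∑ L f)))

  ∑-minus : (L : Lin X) (f g : X → ℚ) → ∑ L (λ x → f x - g x) ≡ ∑ L f - ∑ L g
  ∑-minus L f g = trans (∑-+ L f (λ x → - g x)) (cong (λ y → ∑ L f + y) (∑-neg L g))

  ∑-swap : (L : Lin X) (M : Lin Y) (f : X → Y → ℚ) →
    ∑ L (λ x → ∑ M (f x)) ≡ ∑ M (λ y → ∑ L (λ x → f x y))
  ∑-swap [] M f = sym (∑-0 M)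
  ∑-swap ((c , x) ∷ L) M f = trans (cong₂ _+_ (sym (∑-*ˡ M c (f x))) (∑-swap L M f))
    (sym (∑-+ M (λ y → c * f x y) (λ y → ∑ L (λ x → f x y))))

-- The lowering map Φ

-- (y − T)ⁿ, where (a , b) stands for Tᵃ yᵇ.
shiftPow : ℕ → Lin (ℕ × ℕ)
shiftPow zero = (1ℚ , 0 , 0) ∷ []
shiftPow (suc n) =
  mapL (λ p → proj₁ p , suc (proj₂ p)) (shiftPow n) ++
  negL (mapL (λ p → suc (proj₁ p) , proj₂ p) (shiftPow n))

∑-shiftPow-suc : (n : ℕ) (f : ℕ × ℕ → ℚ) →
  ∑ (shiftPow (suc n)) f ≡
  ∑ (shiftPow n) (λ (a , b) → f (a , suc b)) - ∑ (shiftPow n) (λ (a , b) → f (suc a , b))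
∑-shiftPow-suc n f =
  trans (∑-++ (mapL (λ p → proj₁ p , suc (proj₂ p)) (shiftPow n)) _ f)
    (cong₂ _+_ (∑-mapL _ (shiftPow n) f)
      (trans (∑-negL (mapL (λ p → suc (proj₁ p) , proj₂ p) (shiftPow n)) f)
             (cong -_ (∑-mapL _ (shiftPow n) f))))

-- This is (y − T)ˢ ((x − T) − (y − T))ᵏ = (y − T)ˢ (x − y)ᵏ.
shiftPow-subst : (k s : ℕ) (H : ℕ → ℕ → ℕ → ℚ) →
  ∑ (shiftPow k) (λ (d , l) → ∑ (shiftPow (s +ⁿ d)) (λ (e , j) → ∑ (shiftPow l) (λ (e' , i) → H (e +ⁿ e') j i)))
  ≡ ∑ (shiftPow s) (λ (e , j) → ∑ (shiftPow k) (λ (d , i) → H e (j +ⁿ d) i))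
shiftPow-subst zero s H = begin
  _ ≡⟨ ∑-single (0 , 0) _ ⟩
  _ ≡⟨ ∑-congˡ (cong shiftPow (ℕP.+-identityʳ s)) ⟩
  _ ≡⟨ ∑-cong (shiftPow s) (λ (e , j) → trans (∑-single (0 , 0) _)
        (trans (cong₂ (λ a b → H a b 0) (ℕP.+-identityʳ e) (sym (ℕP.+-identityʳ j)))
               (sym (∑-single (0 , 0) (λ (d , i) → H e (j +ⁿ d) i))))) ⟩
  _ ∎
shiftPow-subst (suc k) s H = begin
  _ ≡⟨ ∑-shiftPow-suc k _ ⟩
  ∑ (shiftPow k) (λ (d , l) → ∑ (shiftPow (s +ⁿ d)) (λ (e , j) → ∑ (shiftPow (suc l)) (λ (e' , i) → H (e +ⁿ e') j i)))
  - ∑ (shiftPow k) (λ (d , l) → ∑ (shiftPow (s +ⁿ suc d)) (λ (e , j) → ∑ (shiftPow l) (λ (e' , i) → H (e +ⁿ e') j i)))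
    -- The induction splits off one factor (x - T) - (y - T). `A`, `D` and `B` carry the extra
    -- factor x, y and T respectively; the two copies of `B` cancel and leave x - y.
    ≡⟨ cong₂ _-_ (∑-cong (shiftPow k) stepˡ) (∑-cong (shiftPow k) stepʳ) ⟩
  ∑ (shiftPow k) (λ p → A p - B p) - ∑ (shiftPow k) (λ p → D p - B p)
    ≡⟨ cong₂ _-_ (∑-minus (shiftPow k) A B) (∑-minus (shiftPow k) D B) ⟩
  (∑ (shiftPow k) A - ∑ (shiftPow k) B) - (∑ (shiftPow k) D - ∑ (shiftPow k) B)
    ≡⟨ solve 3 (λ a b c → (a :+ :- b) :+ :- (c :+ :- b) := a :+ :- c) refl (∑ (shiftPow k) A) (∑ (shiftPow k) B) (∑ (shiftPow k) D) ⟩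
  ∑ (shiftPow k) A - ∑ (shiftPow k) D
    ≡⟨ cong₂ _-_ (shiftPow-subst k s (λ e j i → H e j (suc i))) (shiftPow-subst k s (λ e j i → H e (suc j) i)) ⟩
  ∑ (shiftPow s) (λ (e , j) → ∑ (shiftPow k) (λ (d , i) → H e (j +ⁿ d) (suc i)))
  - ∑ (shiftPow s) (λ (e , j) → ∑ (shiftPow k) (λ (d , i) → H e (suc (j +ⁿ d)) i))
    ≡⟨ sym (∑-minus (shiftPow s) _ _) ⟩
  _ ≡⟨ ∑-cong (shiftPow s) (λ (e , j) → trans
         (cong (λ z → ∑ (shiftPow k) (λ (d , i) → H e (j +ⁿ d) (suc i)) - z)
           (∑-cong (shiftPow k) (λ (d , i) → cong (λ m → H e m i) (sym (ℕP.+-suc j d)))))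
         (sym (∑-shiftPow-suc k (λ (d , i) → H e (j +ⁿ d) i)))) ⟩
  _ ∎
  where
  A B D : ℕ × ℕ → ℚ
  A (d , l) = ∑ (shiftPow (s +ⁿ d)) (λ (e , j) → ∑ (shiftPow l) (λ (e' , i) → H (e +ⁿ e') j (suc i)))
  B (d , l) = ∑ (shiftPow (s +ⁿ d)) (λ (e , j) → ∑ (shiftPow l) (λ (e' , i) → H (suc (e +ⁿ e')) j i))
  D (d , l) = ∑ (shiftPow (s +ⁿ d)) (λ (e , j) → ∑ (shiftPow l) (λ (e' , i) → H (e +ⁿ e') (suc j) i))
  stepˡ : ((d , l) : ℕ × ℕ) →
    ∑ (shiftPow (s +ⁿ d)) (λ (e , j) → ∑ (shiftPow (suc l)) (λ (e' , i) → H (e +ⁿ e') j i)) ≡ A (d , l) - B (d , l)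
  stepˡ (d , l) = trans
    (∑-cong (shiftPow (s +ⁿ d)) (λ (e , j) → trans (∑-shiftPow-suc l _)
      (cong (λ z → ∑ (shiftPow l) (λ (e' , i) → H (e +ⁿ e') j (suc i)) - z)
        (∑-cong (shiftPow l) (λ (e' , i) → cong (λ m → H m j i) (ℕP.+-suc e e'))))))
    (∑-minus (shiftPow (s +ⁿ d)) _ _)
  stepʳ : ((d , l) : ℕ × ℕ) →
    ∑ (shiftPow (s +ⁿ suc d)) (λ (e , j) → ∑ (shiftPow l) (λ (e' , i) → H (e +ⁿ e') j i)) ≡ D (d , l) - B (d , l)
  stepʳ (d , l) = trans (cong (λ m → ∑ (shiftPow m) (λ (e , j) → ∑ (shiftPow l) (λ (e' , i) → H (e +ⁿ e') j i))) (ℕP.+-suc s d)) (∑-shiftPow-suc (s +ⁿ d) _)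

-- Σ_l m_{k,l} v_l, with the drop k − l recorded in the first component.
lowerLetter : ℕ → Lin (ℕ × ℕ)
lowerLetter zero = (1ℚ , 0 , 0) ∷ []
lowerLetter (suc k) = mapL (λ p → proj₁ p , suc (proj₂ p)) (shiftPow k)

lowerTree : Tree → Lin (ℕ × Tree)
lowerTree (leaf k) = mapL (λ p → proj₁ p , leaf (proj₂ p)) (lowerLetter k)
lowerTree (node a b) =
  bindL (lowerTree a) (λ p → mapL (λ q → proj₁ p +ⁿ proj₁ q , node (proj₂ p) (proj₂ q)) (lowerTree b))

∑-lowerTree-node : (a b : Tree) (f : ℕ × Tree → ℚ) →
  ∑ (lowerTree (node a b)) f ≡
  ∑ (lowerTree a) (λ (d , a') → ∑ (lowerTree b) (λ (e , b') → f (d +ⁿ e , node a' b')))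
∑-lowerTree-node a b f = trans (∑-bindL (lowerTree a) _ f) (∑-cong (lowerTree a) (λ p → ∑-mapL _ (lowerTree b) f))

∑-lowerTree-suc : (k : ℕ) (f : ℕ × Tree → ℚ) →
  ∑ (lowerTree (leaf (suc k))) f ≡ ∑ (shiftPow k) (λ (d , l) → f (d , leaf (suc l)))
∑-lowerTree-suc k f = trans (∑-mapL _ (lowerLetter (suc k)) f) (∑-mapL _ (shiftPow k) _)

-- The version of `shiftPow-subst` in many variables: each leaf of index k ≥ 1 has its own x and
-- contributes (x - y)ᵏ⁻¹, a leaf of index 0 contributes 1. As `s` and `H` are arbitrary, one
-- subtree is treated while the other sits in the exponent of y - T and in `H`.
lowerTree-twice : (t : Tree) (s : ℕ) (H : ℕ → ℕ → Tree → ℚ) →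
  ∑ (lowerTree t) (λ (d , t') → ∑ (shiftPow (s +ⁿ d)) (λ (e , j) → ∑ (lowerTree t') (λ (e' , t'') → H (e +ⁿ e') j t'')))
  ≡ ∑ (shiftPow s) (λ (e , j) → ∑ (lowerTree t) (λ (d , t') → H e (j +ⁿ d) t'))
lowerTree-twice (leaf zero) s H = begin
  _ ≡⟨ ∑-single (0 , leaf 0) _ ⟩
  _ ≡⟨ ∑-congˡ (cong shiftPow (ℕP.+-identityʳ s)) ⟩
  _ ≡⟨ ∑-cong (shiftPow s) (λ (e , j) → trans (∑-single (0 , leaf 0) _)
        (trans (cong₂ (λ a b → H a b (leaf 0)) (ℕP.+-identityʳ e) (sym (ℕP.+-identityʳ j)))
               (sym (∑-single (0 , leaf 0) (λ (d , i) → H e (j +ⁿ d) i))))) ⟩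
  _ ∎
lowerTree-twice (leaf (suc k)) s H = begin
  _ ≡⟨ ∑-lowerTree-suc k _ ⟩
  _ ≡⟨ ∑-cong (shiftPow k) (λ (d , l) → ∑-cong (shiftPow (s +ⁿ d)) (λ (e , j) → ∑-lowerTree-suc l _)) ⟩
  _ ≡⟨ shiftPow-subst k s (λ e j i → H e j (leaf (suc i))) ⟩
  _ ≡⟨ ∑-cong (shiftPow s) (λ (e , j) → sym (∑-lowerTree-suc k _)) ⟩
  _ ∎
lowerTree-twice (node a b) s H = begin
  _ ≡⟨ ∑-lowerTree-node a b _ ⟩
  _ ≡⟨ ∑-cong (lowerTree a) (λ (d , a') → ∑-cong (lowerTree b) (λ (d' , b') → trans
        (∑-congˡ (cong shiftPow (sym (ℕP.+-assoc s d d'))))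
        (∑-cong (shiftPow (s +ⁿ d +ⁿ d')) (λ (e , j) → trans (∑-lowerTree-node a' b' _)
          (trans (∑-swap (lowerTree a') (lowerTree b') _)
            (∑-cong (lowerTree b') (λ (e'' , b'') → ∑-cong (lowerTree a') (λ (e' , a'') →
              cong (λ m → H m j (node a'' b'')) (swapʳ e e' e''))))))))) ⟩
  _ ≡⟨ ∑-cong (lowerTree a) (λ (d , a') → lowerTree-twice b (s +ⁿ d)
         (λ e j b'' → ∑ (lowerTree a') (λ (e' , a'') → H (e +ⁿ e') j (node a'' b'')))) ⟩
  _ ≡⟨ ∑-cong (lowerTree a) (λ (d , a') → ∑-cong (shiftPow (s +ⁿ d)) (λ (e , j) →
         ∑-swap (lowerTree b) (lowerTree a') _)) ⟩
  _ ≡⟨ lowerTree-twice a s (λ e j a'' → ∑ (lowerTree b) (λ (d' , b'') → H e (j +ⁿ d') (node a'' b''))) ⟩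
  _ ≡⟨ ∑-cong (shiftPow s) (λ (e , j) → trans
         (∑-cong (lowerTree a) (λ (d , a') → ∑-cong (lowerTree b) (λ (d' , b') →
           cong (λ m → H e m (node a' b')) (ℕP.+-assoc j d d'))))
         (sym (∑-lowerTree-node a b _))) ⟩
  _ ∎
  where
  swapʳ : ∀ x y z → x +ⁿ (y +ⁿ z) ≡ x +ⁿ z +ⁿ y
  swapʳ x y z = trans (cong (x +ⁿ_) (ℕP.+-comm y z)) (sym (ℕP.+-assoc x z y))

-- Ari multiplicities

-- `_/_` normalises by a gcd, so the comparison is made in the unnormalised rationals, where it is
-- an identity of integers.
fromℕq-+ : ∀ m n → fromℕq (m +ⁿ n) ≡ fromℕq m + fromℕq n
fromℕq-+ m n = toℚᵘ-injective (ℚᵘP.≃-trans (toℚᵘ-fromℚᵘ (int (m +ⁿ n))) (ℚᵘP.≃-trans int-+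
  (ℚᵘP.≃-trans (ℚᵘP.+-cong (ℚᵘP.≃-sym (toℚᵘ-fromℚᵘ (int m))) (ℚᵘP.≃-sym (toℚᵘ-fromℚᵘ (int n))))
    (ℚᵘP.≃-sym (toℚᵘ-homo-+ (fromℕq m) (fromℕq n))))))
  where
  int : ℕ → ℚᵘ.ℚᵘ
  int k = ℚᵘ.mkℚᵘ (ℤ.+ k) 0
  int-+ : int (m +ⁿ n) ℚᵘ.≃ int m ℚᵘ.+ int n
  int-+ = ℚᵘ.*≡* (cong (ℤ._* ℤ.1ℤ)
    (sym (cong₂ ℤ._+_ (ℤP.*-identityʳ (ℤ.+ m)) (ℤP.*-identityʳ (ℤ.+ n)))))

sgn-+ : ∀ m n → sgn (m +ⁿ n) ≡ sgn m * sgn n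
sgn-+ zero n = sym (*-identityˡ (sgn n))
sgn-+ (suc m) n = trans (cong -_ (sgn-+ m n)) (neg-distribˡ-* (sgn m) (sgn n))

∑-upTo-suc : (n : ℕ) (f : ℕ → ℚ) → ∑ ⟪ upTo (suc n) ⟫ f ≡ f 0 + ∑ ⟪ upTo n ⟫ (f ∘ suc)
∑-upTo-suc n f = trans (∑-⟪∷⟫ 0 (applyUpTo suc n) f)
  (cong (f 0 +_) (trans (∑-congˡ (cong ⟪_⟫ (sym (LP.map-upTo suc n)))) (∑-⟪map⟫ suc (upTo n) f)))

∑-upTo-last : (n : ℕ) (f : ℕ → ℚ) → ∑ ⟪ upTo (suc n) ⟫ f ≡ ∑ ⟪ upTo n ⟫ f + f n
∑-upTo-last n f = trans (∑-congˡ (cong ⟪_⟫ (sym (LP.upTo-∷ʳ n))))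
  (trans (∑-⟪++⟫ (upTo n) (n ∷ []) f) (cong (∑ ⟪ upTo n ⟫ f +_) (∑-single n f)))

∑-upTo-cong : (n : ℕ) {f g : ℕ → ℚ} → (∀ j → j < n → f j ≡ g j) → ∑ ⟪ upTo n ⟫ f ≡ ∑ ⟪ upTo n ⟫ g
∑-upTo-cong zero h = trans (∑-[] _) (sym (∑-[] _))
∑-upTo-cong (suc n) {f} {g} h = trans (∑-upTo-suc n f) (trans
  (cong₂ _+_ (h 0 (s≤s z≤n)) (∑-upTo-cong n (λ j j<n → h (suc j) (s≤s j<n))))
  (sym (∑-upTo-suc n g)))

private
  -- The coefficient of Tⁿ⁻ʲ yʲ in (y - T)ⁿ; n + j has the parity of n - j and avoids subtraction.
  signedBinomial : ℕ → ℕ → ℚ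
  signedBinomial n j = sgn (n +ⁿ j) * fromℕq (n C j)

  signedBinomial-0 : ∀ n → signedBinomial (suc n) 0 ≡ - signedBinomial n 0
  signedBinomial-0 n = sym (neg-distribˡ-* (sgn (n +ⁿ 0)) 1ℚ)

  signedBinomial-pascal : ∀ n j → signedBinomial (suc n) (suc j) ≡ signedBinomial n j - signedBinomial n (suc j)
  signedBinomial-pascal n j = begin
    - sgn (n +ⁿ suc j) * fromℕq (suc n C suc j)
      ≡⟨ cong₂ (λ m k → - sgn m * fromℕq k) (ℕP.+-suc n j) (sym (nCk+nC[k+1]≡[n+1]C[k+1] n j)) ⟩
    - (- sgn (n +ⁿ j)) * fromℕq (n C j +ⁿ n C suc j)
      ≡⟨ cong (- (- sgn (n +ⁿ j)) *_) (fromℕq-+ (n C j) (n C suc j)) ⟩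
    - (- sgn (n +ⁿ j)) * (fromℕq (n C j) + fromℕq (n C suc j))
      ≡⟨ solve 3 (λ s a b → :- (:- s) :* (a :+ b) := s :* a :+ :- (:- s :* b)) refl (sgn (n +ⁿ j)) (fromℕq (n C j)) (fromℕq (n C suc j)) ⟩
    signedBinomial n j - sgn (suc (n +ⁿ j)) * fromℕq (n C suc j)
      ≡⟨ cong (λ m → signedBinomial n j - sgn m * fromℕq (n C suc j)) (sym (ℕP.+-suc n j)) ⟩
    signedBinomial n j - signedBinomial n (suc j) ∎

  signedBinomial-vanish : ∀ n → signedBinomial n (suc n) ≡ 0ℚ
  signedBinomial-vanish n = trans
    (cong (λ k → sgn (n +ⁿ suc n) * fromℕq k) (k>n⇒nCk≡0 (ℕP.n<1+n n)))
    (*-zeroʳ (sgn (n +ⁿ suc n)))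

-- The binomial theorem for (y - T)ⁿ. It turns the recursive description of the lowering into
-- explicit coefficients, with Pascal's rule as the induction step.
∑-shiftPow : (n : ℕ) (F : ℕ × ℕ → ℚ) →
  ∑ (shiftPow n) F ≡ ∑ ⟪ upTo (suc n) ⟫ (λ j → signedBinomial n j * F (n ∸ j , j))
∑-shiftPow zero F = trans (∑-single (0 , 0) F) (sym (trans (∑-single 0 (λ j → signedBinomial 0 j * F (0 ∸ j , j))) (*-identityˡ (F (0 , 0)))))
∑-shiftPow (suc n) F = begin
  ∑ (shiftPow (suc n)) F
    ≡⟨ ∑-shiftPow-suc n F ⟩
  ∑ (shiftPow n) (λ (a , b) → F (a , suc b)) - ∑ (shiftPow n) (λ (a , b) → F (suc a , b))
    ≡⟨ cong₂ _-_ (∑-shiftPow n (λ (a , b) → F (a , suc b))) (∑-shiftPow n (λ (a , b) → F (suc a , b))) ⟩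
  P - ∑ ⟪ upTo (suc n) ⟫ (λ j → signedBinomial n j * F (suc (n ∸ j) , j))
    ≡⟨ cong (λ z → P - z) (∑-upTo-cong (suc n) (λ { j (s≤s j≤n) →
         cong (λ m → signedBinomial n j * F (m , j)) (sym (ℕP.+-∸-assoc 1 j≤n)) })) ⟩
  P - ∑ ⟪ upTo (suc n) ⟫ q
    ≡⟨ cong (λ z → P - z) (sym (+-identityʳ _)) ⟩
  P - (∑ ⟪ upTo (suc n) ⟫ q + 0ℚ)
    -- The zero is written as the term j = n + 1, whose binomial coefficient vanishes. Splitting off
    -- j = 0 instead then leaves a sum over the same range as `P`.
    ≡⟨ cong (λ z → P - (∑ ⟪ upTo (suc n) ⟫ q + z))
         (sym (trans (cong (_* F (n ∸ n , suc n)) (signedBinomial-vanish n)) (*-zeroˡ (F (n ∸ n , suc n))))) ⟩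
  P - (∑ ⟪ upTo (suc n) ⟫ q + q (suc n))
    ≡⟨ cong (λ z → P - z) (trans (sym (∑-upTo-last (suc n) q)) (∑-upTo-suc (suc n) q)) ⟩
  P - (q 0 + Q)
    ≡⟨ solve 3 (λ p a b → p :+ :- (a :+ b) := :- a :+ (p :+ :- b)) refl P (q 0) Q ⟩
  - q 0 + (P - Q)
    ≡⟨ cong₂ _+_
         (trans (neg-distribˡ-* (signedBinomial n 0) (F (suc n , 0))) (cong (_* F (suc n , 0)) (sym (signedBinomial-0 n))))
         (trans (sym (∑-minus ⟪ upTo (suc n) ⟫ _ (q ∘ suc))) (∑-cong ⟪ upTo (suc n) ⟫ (λ j → trans
           (solve 3 (λ a b y → a :* y :+ :- (b :* y) := (a :+ :- b) :* y) refl (signedBinomial n j) (signedBinomial n (suc j)) (F (n ∸ j , suc j)))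
           (cong (_* F (n ∸ j , suc j)) (sym (signedBinomial-pascal n j)))))) ⟩
  r 0 + ∑ ⟪ upTo (suc n) ⟫ (r ∘ suc)
    ≡⟨ sym (∑-upTo-suc (suc n) r) ⟩
  ∑ ⟪ upTo (suc (suc n)) ⟫ r ∎
  where
  q r : ℕ → ℚ
  q j = signedBinomial n j * F (suc n ∸ j , j)
  r j = signedBinomial (suc n) j * F (suc n ∸ j , j)
  P Q : ℚ
  P = ∑ ⟪ upTo (suc n) ⟫ (λ j → signedBinomial n j * F (n ∸ j , suc j))
  Q = ∑ ⟪ upTo (suc n) ⟫ (q ∘ suc)

ari : ℕ → ℕ → ℚ
ari k l = sgn (k +ⁿ l) * bnm k l

∑-lowerLetter : (k : ℕ) (F : ℕ × ℕ → ℚ) →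
  ∑ (lowerLetter k) F ≡ ∑ ⟪ upTo (suc k) ⟫ (λ l → ari k l * F (k ∸ l , l))
∑-lowerLetter zero F = trans (∑-single (0 , 0) F) (sym (trans (∑-single 0 (λ l → ari 0 l * F (0 ∸ l , l))) (*-identityˡ (F (0 , 0)))))
∑-lowerLetter (suc k) F = begin
  ∑ (lowerLetter (suc k)) F
    ≡⟨ ∑-mapL _ (shiftPow k) F ⟩
  ∑ (shiftPow k) (λ (d , l) → F (d , suc l))
    ≡⟨ ∑-shiftPow k (λ (d , l) → F (d , suc l)) ⟩
  ∑ ⟪ upTo (suc k) ⟫ (λ l → signedBinomial k l * F (k ∸ l , suc l))
    ≡⟨ ∑-cong ⟪ upTo (suc k) ⟫ (λ l → cong (λ s → s * fromℕq (k C l) * F (k ∸ l , suc l))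
         (trans (solve 1 (λ s → s := :- (:- s)) refl (sgn (k +ⁿ l))) (cong (λ m → - sgn m) (sym (ℕP.+-suc k l))))) ⟩
  ∑ ⟪ upTo (suc k) ⟫ (f ∘ suc)
    ≡⟨ sym (+-identityˡ _) ⟩
  0ℚ + ∑ ⟪ upTo (suc k) ⟫ (f ∘ suc)
    -- The term l = 0 may be added because binom(k - 1, -1) = 0 for positive k: a letter of positive
    -- index is never lowered to v_0.
    ≡⟨ cong (_+ ∑ ⟪ upTo (suc k) ⟫ (f ∘ suc))
         (sym (trans (cong (_* F (suc k , 0)) (*-zeroʳ (sgn (suc k +ⁿ 0)))) (*-zeroˡ (F (suc k , 0))))) ⟩
  f 0 + ∑ ⟪ upTo (suc k) ⟫ (f ∘ suc)
    ≡⟨ sym (∑-upTo-suc (suc k) f) ⟩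
  ∑ ⟪ upTo (suc (suc k)) ⟫ f ∎
  where
  f : ℕ → ℚ
  f l = ari (suc k) l * F (suc k ∸ l , l)

mult-∷ : ∀ k ks l ls → mult (k ∷ ks) (l ∷ ls) ≡ ari k l * mult ks ls
mult-∷ k ks l ls = begin
  sgn ((k +ⁿ sum ks) +ⁿ (l +ⁿ sum ls)) * (bnm k l * B)
    ≡⟨ cong (λ m → sgn m * (bnm k l * B)) (interchange k (sum ks) l (sum ls)) ⟩
  sgn ((k +ⁿ l) +ⁿ (sum ks +ⁿ sum ls)) * (bnm k l * B)
    ≡⟨ cong (_* (bnm k l * B)) (sgn-+ (k +ⁿ l) (sum ks +ⁿ sum ls)) ⟩
  sgn (k +ⁿ l) * sgn (sum ks +ⁿ sum ls) * (bnm k l * B)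
    ≡⟨ solve 4 (λ a b c d → a :* b :* (c :* d) := a :* c :* (b :* d)) refl (sgn (k +ⁿ l)) (sgn (sum ks +ⁿ sum ls)) (bnm k l) B ⟩
  ari k l * mult ks ls ∎
  where
  B : ℚ
  B = foldr _*_ 1ℚ (zipWith bnm ks ls)
  open import Algebra.Properties.CommutativeSemigroup ℕP.+-commutativeSemigroup using (interchange)

-- Lowering of words, and of trees through their leaves

lowerWord : List ℕ → Lin (ℕ × List ℕ)
lowerWord [] = (1ℚ , 0 , []) ∷ []
lowerWord (k ∷ ks) =
  bindL (lowerLetter k) (λ p → mapL (λ q → proj₁ p +ⁿ proj₁ q , proj₂ p ∷ proj₂ q) (lowerWord ks))

∑-lowerWord-∷ : (k : ℕ) (ks : List ℕ) (F : ℕ × List ℕ → ℚ) →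
  ∑ (lowerWord (k ∷ ks)) F ≡
  ∑ (lowerLetter k) (λ (d , x) → ∑ (lowerWord ks) (λ (e , l) → F (d +ⁿ e , x ∷ l)))
∑-lowerWord-∷ k ks F = trans (∑-bindL (lowerLetter k) _ F) (∑-cong (lowerLetter k) (λ p → ∑-mapL _ (lowerWord ks) F))

∑-boxes-∷ : (k : ℕ) (ks : List ℕ) (f : List ℕ → ℚ) →
  ∑ ⟪ boxes (k ∷ ks) ⟫ f ≡ ∑ ⟪ upTo (suc k) ⟫ (λ a → ∑ ⟪ boxes ks ⟫ (λ l → f (a ∷ l)))
∑-boxes-∷ k ks f = trans (∑-⟪concatMap⟫ (λ a → map (a ∷_) (boxes ks)) (upTo (suc k)) f)
  (∑-cong ⟪ upTo (suc k) ⟫ (λ a → ∑-⟪map⟫ (a ∷_) (boxes ks) f))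

-- The bound |l| ≤ |k| on the box is what makes the truncated differences |k| ∸ |l| exact, hence
-- additive.
∑-boxes-cong : (ks : List ℕ) {f g : List ℕ → ℚ} → (∀ l → sum l ≤ sum ks → f l ≡ g l) →
  ∑ ⟪ boxes ks ⟫ f ≡ ∑ ⟪ boxes ks ⟫ g
∑-boxes-cong [] {f} {g} h = trans (∑-single [] f) (trans (h [] z≤n) (sym (∑-single [] g)))
∑-boxes-cong (k ∷ ks) {f} {g} h = trans (∑-boxes-∷ k ks f) (trans
  (∑-upTo-cong (suc k) (λ { a (s≤s a≤k) → ∑-boxes-cong ks (λ l l≤ → h (a ∷ l) (ℕP.+-mono-≤ a≤k l≤)) }))
  (sym (∑-boxes-∷ k ks g)))

∸-+-interchange : ∀ {a k s S} → a ≤ k → s ≤ S → (k ∸ a) +ⁿ (S ∸ s) ≡ (k +ⁿ S) ∸ (a +ⁿ s)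
∸-+-interchange {a} {k} {s} {S} a≤k s≤S = begin
  (k ∸ a) +ⁿ (S ∸ s) ≡⟨ sym (ℕP.+-∸-assoc (k ∸ a) s≤S) ⟩
  (k ∸ a) +ⁿ S ∸ s   ≡⟨ cong (_∸ s) (sym (ℕP.+-∸-comm S a≤k)) ⟩
  (k +ⁿ S) ∸ a ∸ s   ≡⟨ ℕP.∸-+-assoc (k +ⁿ S) a s ⟩
  (k +ⁿ S) ∸ (a +ⁿ s) ∎

∑-lowerWord : (ks : List ℕ) (F : ℕ × List ℕ → ℚ) →
  ∑ (lowerWord ks) F ≡ ∑ ⟪ boxes ks ⟫ (λ l → mult ks l * F (sum ks ∸ sum l , l))
∑-lowerWord [] F = trans (∑-single (0 , []) F) (sym (trans (∑-single [] _) (*-identityˡ (F (0 , [])))))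
∑-lowerWord (k ∷ ks) F = begin
  ∑ (lowerWord (k ∷ ks)) F
    ≡⟨ trans (∑-lowerWord-∷ k ks F) (∑-lowerLetter k _) ⟩
  ∑ ⟪ upTo (suc k) ⟫ (λ a → ari k a * ∑ (lowerWord ks) (λ (e , l) → F ((k ∸ a) +ⁿ e , a ∷ l)))
    ≡⟨ ∑-upTo-cong (suc k) (λ { a (s≤s a≤k) → trans (cong (ari k a *_) (∑-lowerWord ks _))
         (trans (sym (∑-*ˡ ⟪ boxes ks ⟫ (ari k a) _)) (∑-boxes-cong ks (λ l l≤ → trans
           (sym (*-assoc (ari k a) (mult ks l) _))
           (cong₂ (λ m d → m * F (d , a ∷ l)) (sym (mult-∷ k ks a l)) (∸-+-interchange a≤k l≤))))) }) ⟩
  ∑ ⟪ upTo (suc k) ⟫ (λ a → ∑ ⟪ boxes ks ⟫ (λ l → mult (k ∷ ks) (a ∷ l) * F (sum (k ∷ ks) ∸ sum (a ∷ l) , a ∷ l)))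
    ≡⟨ sym (∑-boxes-∷ k ks _) ⟩
  ∑ ⟪ boxes (k ∷ ks) ⟫ (λ l → mult (k ∷ ks) l * F (sum (k ∷ ks) ∸ sum l , l)) ∎

relabelS-node : ∀ a b ls → relabelS (node a b) ls ≡
  (let (a' , ls') = relabelS a ls ; (b' , ls'') = relabelS b ls' in node a' b' , ls'')
relabelS-node a b ls with relabelS a ls
... | a' , ls' with relabelS b ls'
... | b' , ls'' = refl

-- The surplus labels `ks` make the induction possible: on a node, `relabelS` hands to the right
-- subtree whatever the left one leaves over.
∑-lowerTree : (t : Tree) (ks : List ℕ) (F : ℕ → Tree × List ℕ → ℚ) →
  ∑ (lowerWord (leaves t ++ ks)) (λ (d , l) → F d (relabelS t l)) ≡
  ∑ (lowerTree t) (λ (d , t') → ∑ (lowerWord ks) (λ (e , l) → F (d +ⁿ e) (t' , l)))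
∑-lowerTree (leaf k) ks F = trans (∑-lowerWord-∷ k ks _) (sym (∑-mapL _ (lowerLetter k) _))
∑-lowerTree (node a b) ks F = begin
  ∑ (lowerWord ((leaves a ++ leaves b) ++ ks)) (λ (d , l) → F d (relabelS (node a b) l))
    ≡⟨ ∑-congˡ (cong lowerWord (LP.++-assoc (leaves a) (leaves b) ks)) ⟩
  ∑ (lowerWord (leaves a ++ (leaves b ++ ks))) (λ (d , l) → F d (relabelS (node a b) l))
    ≡⟨ ∑-cong (lowerWord (leaves a ++ (leaves b ++ ks))) (λ (d , l) → cong (F d) (relabelS-node a b l)) ⟩
  ∑ (lowerWord (leaves a ++ (leaves b ++ ks))) (λ (d , l) → G d (relabelS a l))
    ≡⟨ ∑-lowerTree a (leaves b ++ ks) G ⟩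
  ∑ (lowerTree a) (λ (d , a') → ∑ (lowerWord (leaves b ++ ks)) (λ (e , l) → G (d +ⁿ e) (a' , l)))
    ≡⟨ ∑-cong (lowerTree a) (λ (d , a') → ∑-lowerTree b ks
         (λ e (b' , ls) → F (d +ⁿ e) (node a' b' , ls))) ⟩
  ∑ (lowerTree a) (λ (d , a') → ∑ (lowerTree b) (λ (e , b') → ∑ (lowerWord ks) (λ (f , l) → F (d +ⁿ (e +ⁿ f)) (node a' b' , l))))
    ≡⟨ ∑-cong (lowerTree a) (λ (d , a') → ∑-cong (lowerTree b) (λ (e , b') → ∑-cong (lowerWord ks) (λ (f , l) →
         cong (λ m → F m (node a' b' , l)) (sym (ℕP.+-assoc d e f))))) ⟩
  ∑ (lowerTree a) (λ (d , a') → ∑ (lowerTree b) (λ (e , b') → ∑ (lowerWord ks) (λ (f , l) → F (d +ⁿ e +ⁿ f) (node a' b' , l))))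
    ≡⟨ sym (∑-lowerTree-node a b _) ⟩
  _ ∎
  where
  G : ℕ → Tree × List ℕ → ℚ
  G d (a' , ls) = F d (let (b' , ls') = relabelS b ls in node a' b' , ls')

∑-mag-leaf : (t : Tree) (s : ℕ) (f : Tree → ℚ) →
  ∑ (mag t (leaf (suc s))) f ≡ ∑ (lowerTree t) (λ (d , t') → f (node (leaf (suc s +ⁿ d)) t'))
∑-mag-leaf t s f = begin
  ∑ (mag t (leaf (suc s))) f
    ≡⟨ ∑-mapCoef (mult (leaves t)) _ (boxes (leaves t)) f ⟩
  ∑ ⟪ boxes (leaves t) ⟫ (λ l → mult (leaves t) l * f (node (leaf (suc s +ⁿ sum (leaves t) ∸ sum l)) (relabel t l)))
    ≡⟨ ∑-boxes-cong (leaves t) (λ l l≤ → cong (λ m → mult (leaves t) l * f (node (leaf m) (relabel t l))) (ℕP.+-∸-assoc (suc s) l≤)) ⟩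
  ∑ ⟪ boxes (leaves t) ⟫ (λ l → mult (leaves t) l * F (sum (leaves t) ∸ sum l) (relabelS t l))
    ≡⟨ sym (∑-lowerWord (leaves t) _) ⟩
  ∑ (lowerWord (leaves t)) (λ (d , l) → F d (relabelS t l))
    ≡⟨ ∑-congˡ (cong lowerWord (sym (LP.++-identityʳ (leaves t)))) ⟩
  ∑ (lowerWord (leaves t ++ [])) (λ (d , l) → F d (relabelS t l))
    ≡⟨ ∑-lowerTree t [] F ⟩
  ∑ (lowerTree t) (λ (d , t') → ∑ (lowerWord []) (λ (e , l) → F (d +ⁿ e) (t' , l)))
    ≡⟨ ∑-cong (lowerTree t) (λ (d , t') → trans (∑-single (0 , []) _) (cong (λ m → F m (t' , [])) (ℕP.+-identityʳ d))) ⟩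
  ∑ (lowerTree t) (λ (d , t') → F d (t' , [])) ∎
  where
  F : ℕ → Tree × List ℕ → ℚ
  F d (t' , _) = f (node (leaf (suc s +ⁿ d)) t')

-- The action of a product of magma elements on a letter

∑-mag-node : (t a b : Tree) (f : Tree → ℚ) →
  ∑ (mag t (node a b)) f ≡ ∑ (mag t a) (λ a' → f (node a' b)) + ∑ (mag t b) (λ b' → f (node a b'))
∑-mag-node t a b f = trans (∑-++ (mapL (λ a' → node a' b) (mag t a)) _ f)
  (cong₂ _+_ (∑-mapL _ (mag t a) f) (∑-mapL _ (mag t b) f))

-- Since `g` may depend on the drop, this is commutation with Φ separately for each power of T. On
-- v_0 both sides vanish, and on a letter of positive index it is `lowerTree-twice`. On a node Φ is
-- multiplicative and `mag t` a derivation.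
lowerTree-mag : (t u : Tree) (g : ℕ → Tree → ℚ) →
  ∑ (lowerTree u) (λ (d , u') → ∑ (mag t u') (g d)) ≡
  ∑ (mag t u) (λ u' → ∑ (lowerTree u') (λ (d , u'') → g d u''))
lowerTree-mag t (leaf zero) g = trans (∑-single (0 , leaf 0) _) (trans (∑-[] (g 0)) (sym (∑-[] _)))
lowerTree-mag t (leaf (suc s)) g = begin
  _ ≡⟨ ∑-lowerTree-suc s _ ⟩
  _ ≡⟨ ∑-cong (shiftPow s) (λ (d , l) → ∑-mag-leaf t l (g d)) ⟩
  _ ≡⟨ sym (lowerTree-twice t s (λ e j t' → g e (node (leaf (suc j)) t'))) ⟩
  _ ≡⟨ ∑-cong (lowerTree t) (λ (d , t') →
         trans (sym (∑-lowerTree-suc (s +ⁿ d) _)) (sym (∑-lowerTree-node (leaf (suc s +ⁿ d)) t' _))) ⟩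
  _ ≡⟨ sym (∑-mag-leaf t s _) ⟩
  _ ∎
lowerTree-mag t (node a b) g = begin
  _ ≡⟨ ∑-lowerTree-node a b _ ⟩
  _ ≡⟨ ∑-cong (lowerTree a) (λ (d , a') → trans
         (∑-cong (lowerTree b) (λ (e , b') → ∑-mag-node t a' b' (g (d +ⁿ e))))
         (∑-+ (lowerTree b) _ _)) ⟩
  _ ≡⟨ ∑-+ (lowerTree a) _ _ ⟩
  ∑ (lowerTree a) (λ (d , a') → ∑ (lowerTree b) (λ (e , b') → ∑ (mag t a') (λ x → g (d +ⁿ e) (node x b')))) +
  ∑ (lowerTree a) (λ (d , a') → ∑ (lowerTree b) (λ (e , b') → ∑ (mag t b') (λ y → g (d +ⁿ e) (node a' y))))
    ≡⟨ cong₂ _+_ left right ⟩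
  ∑ (mag t a) (λ x → ∑ (lowerTree (node x b)) (λ (d , u) → g d u)) +
  ∑ (mag t b) (λ y → ∑ (lowerTree (node a y)) (λ (d , u) → g d u))
    ≡⟨ sym (∑-mag-node t a b _) ⟩
  _ ∎
  where
  left : ∑ (lowerTree a) (λ (d , a') → ∑ (lowerTree b) (λ (e , b') → ∑ (mag t a') (λ x → g (d +ⁿ e) (node x b')))) ≡
         ∑ (mag t a) (λ x → ∑ (lowerTree (node x b)) (λ (d , u) → g d u))
  left = begin
    _ ≡⟨ ∑-cong (lowerTree a) (λ (d , a') → ∑-swap (lowerTree b) (mag t a') _) ⟩
    _ ≡⟨ lowerTree-mag t a (λ d x → ∑ (lowerTree b) (λ (e , b') → g (d +ⁿ e) (node x b'))) ⟩
    _ ≡⟨ ∑-cong (mag t a) (λ x → sym (∑-lowerTree-node x b _)) ⟩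
    _ ∎
  right : ∑ (lowerTree a) (λ (d , a') → ∑ (lowerTree b) (λ (e , b') → ∑ (mag t b') (λ y → g (d +ⁿ e) (node a' y)))) ≡
          ∑ (mag t b) (λ y → ∑ (lowerTree (node a y)) (λ (d , u) → g d u))
  right = begin
    _ ≡⟨ ∑-cong (lowerTree a) (λ (d , a') → lowerTree-mag t b (λ e y → g (d +ⁿ e) (node a' y))) ⟩
    _ ≡⟨ ∑-swap (lowerTree a) (mag t b) _ ⟩
    _ ≡⟨ ∑-cong (mag t b) (λ y → sym (∑-lowerTree-node a y _)) ⟩
    _ ∎

lowerTrees : {n : ℕ} → Vec Tree n → Lin (ℕ × Vec Tree n)
lowerTrees [] = (1ℚ , 0 , []) ∷ []
lowerTrees (u ∷ A) =
  bindL (lowerTree u) (λ p → mapL (λ q → proj₁ p +ⁿ proj₁ q , proj₂ p ∷ proj₂ q) (lowerTrees A))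

∑-lowerTrees-∷ : {n : ℕ} (u : Tree) (A : Vec Tree n) (f : ℕ × Vec Tree (suc n) → ℚ) →
  ∑ (lowerTrees (u ∷ A)) f ≡
  ∑ (lowerTree u) (λ (d , u') → ∑ (lowerTrees A) (λ (e , A') → f (d +ⁿ e , u' ∷ A')))
∑-lowerTrees-∷ u A f = trans (∑-bindL (lowerTree u) _ f) (∑-cong (lowerTree u) (λ p → ∑-mapL _ (lowerTrees A) f))

∑-derVec-∷ : {n : ℕ} (t u : Tree) (A : Vec Tree n) (f : Vec Tree (suc n) → ℚ) →
  ∑ (derVec t (u ∷ A)) f ≡ ∑ (mag t u) (λ u' → f (u' ∷ A)) + ∑ (derVec t A) (λ A' → f (u ∷ A'))
∑-derVec-∷ t u A f = trans (∑-++ (mapL (_∷ A) (mag t u)) _ f)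
  (cong₂ _+_ (∑-mapL _ (mag t u) f) (∑-mapL _ (derVec t A) f))

lowerTrees-derVec : {n : ℕ} (t : Tree) (A : Vec Tree n) (g : ℕ → Vec Tree n → ℚ) →
  ∑ (lowerTrees A) (λ (d , A') → ∑ (derVec t A') (g d)) ≡
  ∑ (derVec t A) (λ A' → ∑ (lowerTrees A') (λ (d , A'') → g d A''))
lowerTrees-derVec t [] g = trans (∑-single (0 , []) _) (trans (∑-[] (g 0)) (sym (∑-[] _)))
lowerTrees-derVec t (u ∷ A) g = begin
  _ ≡⟨ ∑-lowerTrees-∷ u A _ ⟩
  _ ≡⟨ ∑-cong (lowerTree u) (λ (d , u') → trans
         (∑-cong (lowerTrees A) (λ (e , A') → ∑-derVec-∷ t u' A' (g (d +ⁿ e))))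
         (∑-+ (lowerTrees A) _ _)) ⟩
  _ ≡⟨ ∑-+ (lowerTree u) _ _ ⟩
  ∑ (lowerTree u) (λ (d , u') → ∑ (lowerTrees A) (λ (e , A') → ∑ (mag t u') (λ x → g (d +ⁿ e) (x ∷ A')))) +
  ∑ (lowerTree u) (λ (d , u') → ∑ (lowerTrees A) (λ (e , A') → ∑ (derVec t A') (λ B → g (d +ⁿ e) (u' ∷ B))))
    ≡⟨ cong₂ _+_ left right ⟩
  ∑ (mag t u) (λ x → ∑ (lowerTrees (x ∷ A)) (λ (d , B) → g d B)) +
  ∑ (derVec t A) (λ B → ∑ (lowerTrees (u ∷ B)) (λ (d , B') → g d B'))
    ≡⟨ sym (∑-derVec-∷ t u A _) ⟩
  _ ∎
  where
  left : ∑ (lowerTree u) (λ (d , u') → ∑ (lowerTrees A) (λ (e , A') → ∑ (mag t u') (λ x → g (d +ⁿ e) (x ∷ A')))) ≡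
         ∑ (mag t u) (λ x → ∑ (lowerTrees (x ∷ A)) (λ (d , B) → g d B))
  left = begin
    _ ≡⟨ ∑-cong (lowerTree u) (λ (d , u') → ∑-swap (lowerTrees A) (mag t u') _) ⟩
    _ ≡⟨ lowerTree-mag t u (λ d x → ∑ (lowerTrees A) (λ (e , A') → g (d +ⁿ e) (x ∷ A'))) ⟩
    _ ≡⟨ ∑-cong (mag t u) (λ x → sym (∑-lowerTrees-∷ x A _)) ⟩
    _ ∎
  right : ∑ (lowerTree u) (λ (d , u') → ∑ (lowerTrees A) (λ (e , A') → ∑ (derVec t A') (λ B → g (d +ⁿ e) (u' ∷ B)))) ≡
          ∑ (derVec t A) (λ B → ∑ (lowerTrees (u ∷ B)) (λ (d , B') → g d B'))
  right = begin
    _ ≡⟨ ∑-cong (lowerTree u) (λ (d , u') → lowerTrees-derVec t A (λ e B → g (d +ⁿ e) (u' ∷ B))) ⟩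
    _ ≡⟨ ∑-swap (lowerTree u) (derVec t A) _ ⟩
    _ ≡⟨ ∑-cong (derVec t A) (λ B → sym (∑-lowerTrees-∷ u B _)) ⟩
    _ ∎

comb : {n : ℕ} → Tree → Vec Tree n → Tree
comb y A = foldl node y (toList A)

∑-mag-comb : {n : ℕ} (t y : Tree) (A : Vec Tree n) (f : Tree → ℚ) →
  ∑ (mag t (comb y A)) f ≡ ∑ (mag t y) (λ y' → f (comb y' A)) + ∑ (derVec t A) (λ A' → f (comb y A'))
∑-mag-comb t y [] f = sym (trans (cong (∑ (mag t y) f +_) (∑-[] _)) (+-identityʳ _))
∑-mag-comb t y (u ∷ A) f = begin
  _ ≡⟨ ∑-mag-comb t (node y u) A f ⟩
  ∑ (mag t (node y u)) (λ z → f (comb z A)) + D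
    ≡⟨ cong (_+ D) (∑-mag-node t y u _) ⟩
  (∑ (mag t y) (λ y' → f (comb (node y' u) A)) + ∑ (mag t u) (λ u' → f (comb (node y u') A))) + D
    ≡⟨ +-assoc (∑ (mag t y) (λ y' → f (comb (node y' u) A))) (∑ (mag t u) (λ u' → f (comb (node y u') A))) D ⟩
  ∑ (mag t y) (λ y' → f (comb (node y' u) A)) + (∑ (mag t u) (λ u' → f (comb (node y u') A)) + D)
    ≡⟨ cong (∑ (mag t y) (λ y' → f (comb (node y' u) A)) +_) (sym (∑-derVec-∷ t u A _)) ⟩
  _ ∎
  where
  D : ℚ
  D = ∑ (derVec t A) (λ A' → f (comb (node y u) A'))

∑-act-∷ : {n : ℕ} (t : Tree) (A : Vec Tree n) (y : Tree) (f : Tree → ℚ) →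
  ∑ (act (t ∷ A) y) f ≡
  ∑ (act A y) (λ z → ∑ (mag t z) f) - ∑ (derVec t A) (λ A' → ∑ (act A' y) f)
∑-act-∷ t A y f = trans (∑-++ (bindL (act A y) (mag t)) _ f)
  (cong₂ _+_ (∑-bindL (act A y) (mag t) f)
    (trans (∑-negL (bindL (derVec t A) (λ A' → act A' y)) f) (cong -_ (∑-bindL (derVec t A) _ f))))

-- By lowerTrees-derVec the terms in which x acts on the tᵢ inside A ▷ y are
-- exactly those of (x ▷ A) ▷ y.
∑-act-suc : {n : ℕ} (A : Vec Tree n) (s : ℕ) (f : Tree → ℚ) →
  ∑ (act A (leaf (suc s))) f ≡ ∑ (lowerTrees A) (λ (d , A') → f (comb (leaf (suc s +ⁿ d)) A'))
∑-act-suc [] s f = trans (∑-single _ f)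
  (sym (trans (∑-single (0 , []) _) (cong (λ m → f (leaf (suc m))) (ℕP.+-identityʳ s))))
∑-act-suc (t ∷ A) s f = begin
  ∑ (act (t ∷ A) y) f
    ≡⟨ ∑-act-∷ t A y f ⟩
  ∑ (act A y) (λ z → ∑ (mag t z) f) - ∑ (derVec t A) (λ A' → ∑ (act A' y) f)
    ≡⟨ cong₂ _-_ (∑-act-suc A s _) (∑-cong (derVec t A) (λ A' → ∑-act-suc A' s f)) ⟩
  ∑ (lowerTrees A) (λ (d , A') → ∑ (mag t (comb (leaf (suc s +ⁿ d)) A')) f) - R
    ≡⟨ cong (_- R) (trans (∑-cong (lowerTrees A) (λ (d , A') → ∑-mag-comb t (leaf (suc s +ⁿ d)) A' f))
         (∑-+ (lowerTrees A) _ _)) ⟩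
  (L + ∑ (lowerTrees A) (λ (d , A') → ∑ (derVec t A') (λ A'' → f (comb (leaf (suc s +ⁿ d)) A'')))) - R
    ≡⟨ cong (λ z → (L + z) - R) (lowerTrees-derVec t A _) ⟩
  (L + R) - R
    ≡⟨ solve 2 (λ l r → (l :+ r) :+ :- r := l) refl L R ⟩
  L
    -- What survives is `t` acting on the innermost letter. It inserts the lowered t' next to that
    -- letter, and `comb (node y t') A'` is `comb y (t' ∷ A')` by definition.
    ≡⟨ ∑-cong (lowerTrees A) (λ (d , A') → ∑-mag-leaf t (s +ⁿ d) _) ⟩
  ∑ (lowerTrees A) (λ (d , A') → ∑ (lowerTree t) (λ (e , t') → f (comb (node (leaf (suc s +ⁿ d +ⁿ e)) t') A')))
    ≡⟨ ∑-swap (lowerTrees A) (lowerTree t) _ ⟩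
  ∑ (lowerTree t) (λ (e , t') → ∑ (lowerTrees A) (λ (d , A') → f (comb (node (leaf (suc s +ⁿ d +ⁿ e)) t') A')))
    ≡⟨ ∑-cong (lowerTree t) (λ (e , t') → ∑-cong (lowerTrees A) (λ (d , A') →
         cong (λ m → f (comb (node (leaf (suc m)) t') A')) (trans (ℕP.+-assoc s d e) (cong (s +ⁿ_) (ℕP.+-comm d e))))) ⟩
  ∑ (lowerTree t) (λ (e , t') → ∑ (lowerTrees A) (λ (d , A') → f (comb (node (leaf (suc s +ⁿ (e +ⁿ d))) t') A')))
    ≡⟨ sym (∑-lowerTrees-∷ t A _) ⟩
  _ ∎
  where
  y : Tree
  y = leaf (suc s)
  L R : ℚ
  L = ∑ (lowerTrees A) (λ (d , A') → ∑ (mag t (leaf (suc s +ⁿ d))) (λ z → f (comb z A')))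
  R = ∑ (derVec t A) (λ A' → ∑ (lowerTrees A') (λ (d , A'') → f (comb (leaf (suc s +ⁿ d)) A'')))

-- Induction on the number of factors: `derVec` preserves the length, so (x ▷ A) ▷ v_0 is again the
-- action of a nonempty product, with one factor fewer than x A.
∑-act-zero : {n : ℕ} (t : Tree) (A : Vec Tree n) (f : Tree → ℚ) → ∑ (act (t ∷ A) (leaf 0)) f ≡ 0ℚ
∑-act-zero t [] f = trans (∑-act-∷ t [] (leaf 0) f)
  (cong₂ _-_ (trans (∑-single (leaf 0) _) (∑-[] f)) (∑-[] _))
∑-act-zero t (u ∷ A) f = trans (∑-act-∷ t (u ∷ A) (leaf 0) f)
  (cong₂ _-_ (∑-act-zero u A _) (∑-zero (derVec t (u ∷ A)) (λ { (u' ∷ A') → ∑-act-zero u' A' f })))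

∑-lowerTrees-leaves : (u : List ℕ) (F : ℕ → List Tree → ℚ) →
  ∑ (lowerTrees (fromList (map leaf u))) (λ (d , A) → F d (toList A)) ≡
  ∑ (lowerWord u) (λ (d , l) → F d (map leaf l))
∑-lowerTrees-leaves [] F = trans (∑-single (0 , []) _) (sym (∑-single (0 , []) _))
∑-lowerTrees-leaves (k ∷ u) F = begin
  _ ≡⟨ ∑-lowerTrees-∷ (leaf k) (fromList (map leaf u)) _ ⟩
  _ ≡⟨ ∑-mapL _ (lowerLetter k) _ ⟩
  _ ≡⟨ ∑-cong (lowerLetter k) (λ (d , x) → ∑-lowerTrees-leaves u (λ e A → F (d +ⁿ e) (leaf x ∷ A))) ⟩
  _ ≡⟨ sym (∑-lowerWord-∷ k u _) ⟩
  _ ∎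

-- Words: products, deshuffles and iterated brackets

∑-mulL : (a b : Lin (List ℕ)) (f : List ℕ → ℚ) → ∑ (mulL a b) f ≡ ∑ a (λ u → ∑ b (λ w → f (u ++ w)))
∑-mulL a b f = trans (∑-bindL a _ f) (∑-cong a (λ u → trans (∑-bindL b _ f) (∑-cong b (λ w → ∑-single (u ++ w) f))))

∑-desh-∷ : (x : ℕ) (w : List ℕ) (f : List ℕ × List ℕ → ℚ) →
  ∑ ⟪ desh (x ∷ w) ⟫ f ≡ ∑ ⟪ desh w ⟫ (λ (a , b) → f (x ∷ a , b) + f (a , x ∷ b))
∑-desh-∷ x w f = trans (∑-⟪concatMap⟫ _ (desh w) f)
  (∑-cong ⟪ desh w ⟫ (λ p → trans (∑-⟪∷⟫ _ _ f) (cong (f (x ∷ proj₁ p , proj₂ p) +_) (∑-single _ f))))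

-- An iterated right bracket is y ↦ Σ S(l₍₁₎) y l₍₂₎.
∑-expT-comb : (l : List ℕ) (y : Tree) (F : List ℕ → ℚ) →
  ∑ (expT (foldl node y (map leaf l))) F ≡
  ∑ (expT y) (λ w → ∑ ⟪ desh l ⟫ (λ (a , b) → sgn (length a) * F (a ʳ++ w ++ b)))
∑-expT-comb [] y F = ∑-cong (expT y) (λ w → sym (trans (∑-single ([] , []) _)
  (trans (*-identityˡ _) (cong F (LP.++-identityʳ w)))))
∑-expT-comb (x ∷ l) y F = begin
  ∑ (expT (foldl node (node y (leaf x)) (map leaf l))) F
    ≡⟨ ∑-expT-comb l (node y (leaf x)) F ⟩
  ∑ (expT (node y (leaf x))) G
    ≡⟨ ∑-++ (mulL (expT y) (expT (leaf x))) _ G ⟩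
  ∑ (mulL (expT y) (expT (leaf x))) G + ∑ (negL (mulL (expT (leaf x)) (expT y))) G
    ≡⟨ cong₂ _+_ (trans (∑-mulL (expT y) _ G) (∑-cong (expT y) (λ w → ∑-single (x ∷ []) (λ z → G (w ++ z)))))
         (trans (∑-negL (mulL (expT (leaf x)) (expT y)) G)
           (cong -_ (trans (∑-mulL (expT (leaf x)) (expT y) G) (∑-single (x ∷ []) (λ z → ∑ (expT y) (λ w → G (z ++ w))))))) ⟩
  ∑ (expT y) (λ w → G (w ++ x ∷ [])) - ∑ (expT y) (λ w → G (x ∷ w))
    ≡⟨ sym (∑-minus (expT y) _ _) ⟩
  ∑ (expT y) (λ w → G (w ++ x ∷ []) - G (x ∷ w))
    -- The two terms of w x - x w are the two summands of `desh (x ∷ l)`. For the second,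
    -- `(x ∷ a) ʳ++ w` is `a ʳ++ (x ∷ w)` by definition, and the sign is that of one more letter on
    -- the left.
    ≡⟨ ∑-cong (expT y) (λ w → trans (sym (∑-minus ⟪ desh l ⟫ _ _)) (trans
         (∑-cong ⟪ desh l ⟫ (λ (a , b) → trans
           (cong (λ z → sgn (length a) * F (a ʳ++ z) - sgn (length a) * F (a ʳ++ x ∷ w ++ b)) (LP.++-assoc w (x ∷ []) b))
           (solve 3 (λ s p q → s :* p :+ :- (s :* q) := :- s :* q :+ s :* p) refl
             (sgn (length a)) (F (a ʳ++ w ++ x ∷ b)) (F (a ʳ++ x ∷ w ++ b)))))
         (sym (∑-desh-∷ x l _)))) ⟩
  _ ∎
  where
  G : List ℕ → ℚ
  G w = ∑ ⟪ desh l ⟫ (λ (a , b) → sgn (length a) * F (a ʳ++ w ++ b))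

∑-act-word : (u : List ℕ) (s : ℕ) (F : List ℕ → ℚ) →
  ∑ (act (fromList (map leaf u)) (leaf (suc s))) (λ y → ∑ (expT y) F) ≡
  ∑ (lowerWord u) (λ (d , l) → ∑ ⟪ desh l ⟫ (λ (a , b) → sgn (length a) * F (a ʳ++ (suc s +ⁿ d) ∷ b)))
∑-act-word u s F = begin
  _ ≡⟨ ∑-act-suc (fromList (map leaf u)) s _ ⟩
  _ ≡⟨ ∑-lowerTrees-leaves u (λ d A → ∑ (expT (foldl node (leaf (suc s +ⁿ d)) A)) F) ⟩
  _ ≡⟨ ∑-cong (lowerWord u) (λ (d , l) → trans (∑-expT-comb l (leaf (suc s +ⁿ d)) F) (∑-single _ _)) ⟩
  _ ∎

-- Duality of products and coproducts on words

-- Defined by recursion, unlike the decision procedure in `coeff`. Thus δ factors over the letters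
-- of a word, cancels common successors, and vanishes at a successor against zero, all by
-- computation.
δ : ℕ → ℕ → ℚ
δ zero zero = 1ℚ
δ zero (suc n) = 0ℚ
δ (suc m) zero = 0ℚ
δ (suc m) (suc n) = δ m n

δL : List ℕ → List ℕ → ℚ
δL [] [] = 1ℚ
δL [] (y ∷ ys) = 0ℚ
δL (x ∷ xs) [] = 0ℚ
δL (x ∷ xs) (y ∷ ys) = δ x y * δL xs ys

δ-refl : ∀ n → δ n n ≡ 1ℚ
δ-refl zero = refl
δ-refl (suc n) = δ-refl n

δ-≢ : ∀ {m n} → m ≢ n → δ m n ≡ 0ℚ
δ-≢ {zero} {zero} h = ⊥-elim (h refl)
δ-≢ {zero} {suc n} h = refl
δ-≢ {suc m} {zero} h = refl
δ-≢ {suc m} {suc n} h = δ-≢ (h ∘ cong suc)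

δ-cong : ∀ {m n m' n'} → (m ≡ n → m' ≡ n') → (m' ≡ n' → m ≡ n) → δ m n ≡ δ m' n'
δ-cong {m} {n} {m'} {n'} to from with m ℕ.≟ n
... | yes refl = trans (δ-refl m) (sym (trans (cong (δ m') (sym (to refl))) (δ-refl m')))
... | no m≢n = trans (δ-≢ m≢n) (sym (δ-≢ (m≢n ∘ from)))

δL-refl : ∀ xs → δL xs xs ≡ 1ℚ
δL-refl [] = refl
δL-refl (x ∷ xs) = trans (cong₂ _*_ (δ-refl x) (δL-refl xs)) (*-identityˡ 1ℚ)

δL-≢ : ∀ {xs ys} → xs ≢ ys → δL xs ys ≡ 0ℚ
δL-≢ {[]} {[]} h = ⊥-elim (h refl)
δL-≢ {[]} {y ∷ ys} h = refl
δL-≢ {x ∷ xs} {[]} h = refl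
δL-≢ {x ∷ xs} {y ∷ ys} h with x ℕ.≟ y
... | no x≢y = trans (cong (_* δL xs ys) (δ-≢ x≢y)) (*-zeroˡ (δL xs ys))
... | yes refl = trans (cong (δ x x *_) (δL-≢ (h ∘ cong (x ∷_)))) (*-zeroʳ (δ x x))

δL-cong : ∀ {xs ys xs' ys'} → (xs ≡ ys → xs' ≡ ys') → (xs' ≡ ys' → xs ≡ ys) → δL xs ys ≡ δL xs' ys'
δL-cong {xs} {ys} {xs'} {ys'} to from with LP.≡-dec ℕ._≟_ xs ys
... | yes refl = trans (δL-refl xs) (sym (trans (cong (δL xs') (sym (to refl))) (δL-refl xs')))
... | no xs≢ys = trans (δL-≢ xs≢ys) (sym (δL-≢ (xs≢ys ∘ from)))

δL-sym : ∀ xs ys → δL xs ys ≡ δL ys xs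
δL-sym xs ys = δL-cong {xs} {ys} sym sym

δL-reverse : ∀ xs ys → δL (reverse xs) ys ≡ δL xs (reverse ys)
δL-reverse xs ys = δL-cong {reverse xs} {ys}
  (λ e → trans (sym (LP.reverse-involutive xs)) (cong reverse e))
  (λ e → trans (cong reverse e) (LP.reverse-involutive ys))

δL-subst : ∀ xs ys (f : List ℕ → ℚ) → f xs * δL xs ys ≡ f ys * δL xs ys
δL-subst xs ys f with LP.≡-dec ℕ._≟_ xs ys
... | yes refl = refl
... | no xs≢ys = trans (trans (cong (f xs *_) (δL-≢ xs≢ys)) (*-zeroʳ (f xs)))
  (sym (trans (cong (f ys *_) (δL-≢ xs≢ys)) (*-zeroʳ (f ys))))

private
  indicator-yes : ∀ {i} c r → i ≡ 1ℚ → c + r ≡ c * i + r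
  indicator-yes c r refl = cong (_+ r) (sym (*-identityʳ c))

  indicator-no : ∀ {i} c r → i ≡ 0ℚ → r ≡ c * i + r
  indicator-no c r refl = sym (trans (cong (_+ r) (*-zeroʳ c)) (+-identityˡ r))

coeff-∑ : (L : Lin (List ℕ)) (w : List ℕ) → coeff L w ≡ ∑ L (λ u → δL u w)
coeff-∑ [] w = sym (∑-[] _)
coeff-∑ ((c , u) ∷ L) w with LP.≡-dec ℕ._≟_ u w
... | yes refl = trans (cong (c +_) (coeff-∑ L w)) (trans (indicator-yes c _ (δL-refl u)) (sym (∑-∷ c u L _)))
... | no u≢w = trans (coeff-∑ L w) (trans (indicator-no c _ (δL-≢ u≢w)) (sym (∑-∷ c u L _)))

δL²-≢ : ∀ u v w z → (u , v) ≢ (w , z) → δL u w * δL v z ≡ 0ℚ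
δL²-≢ u v w z h with LP.≡-dec ℕ._≟_ u w
... | no u≢w = trans (cong (_* δL v z) (δL-≢ u≢w)) (*-zeroˡ (δL v z))
... | yes refl = trans (cong (δL u u *_) (δL-≢ (h ∘ cong (u ,_)))) (*-zeroʳ (δL u u))

coeff2-∑ : (L : Lin (List ℕ × List ℕ)) (u w : List ℕ) →
  coeff2 L (u , w) ≡ ∑ L (λ (x , y) → δL x u * δL y w)
coeff2-∑ [] u w = sym (∑-[] _)
coeff2-∑ ((c , x , y) ∷ L) u w with PP.≡-dec (LP.≡-dec ℕ._≟_) (LP.≡-dec ℕ._≟_) (x , y) (u , w)
... | yes refl = trans (cong (c +_) (coeff2-∑ L x y)) (trans
  (indicator-yes c _ (trans (cong₂ _*_ (δL-refl x) (δL-refl y)) (*-identityˡ 1ℚ))) (sym (∑-∷ c (x , y) L _)))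
... | no ≢uw = trans (coeff2-∑ L u w) (trans (indicator-no c _ (δL²-≢ x y u w ≢uw)) (sym (∑-∷ c (x , y) L _)))

∑-prefixes-∷ : (x : ℕ) (xs : List ℕ) (f : List ℕ × List ℕ → ℚ) →
  ∑ ⟪ prefixes (x ∷ xs) ⟫ f ≡ f ([] , x ∷ xs) + ∑ ⟪ prefixes xs ⟫ (λ (p , r) → f (x ∷ p , r))
∑-prefixes-∷ x xs f = trans (∑-⟪∷⟫ _ _ f) (cong (f ([] , x ∷ xs) +_) (∑-⟪map⟫ _ (prefixes xs) f))

-- Concatenation is dual to deconcatenation: at most one cut of k contributes, the length of x
-- deciding where.
δL-++ : ∀ x y k → δL (x ++ y) k ≡ ∑ ⟪ prefixes k ⟫ (λ (p , r) → δL x p * δL y r)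
δL-++ [] y [] = sym (trans (∑-single ([] , []) _) (*-identityˡ (δL y [])))
δL-++ [] y (c ∷ k) = sym (trans (∑-prefixes-∷ c k _) (trans
  (cong₂ _+_ (*-identityˡ (δL y (c ∷ k))) (∑-zero ⟪ prefixes k ⟫ (λ (p , r) → *-zeroˡ (δL y r))))
  (+-identityʳ (δL y (c ∷ k)))))
δL-++ (a ∷ x) y [] = sym (trans (∑-single ([] , []) _) (*-zeroˡ (δL y [])))
δL-++ (a ∷ x) y (c ∷ k) = begin
  δ a c * δL (x ++ y) k
    ≡⟨ cong (δ a c *_) (δL-++ x y k) ⟩
  δ a c * ∑ ⟪ prefixes k ⟫ (λ (p , r) → δL x p * δL y r)
    ≡⟨ sym (∑-*ˡ ⟪ prefixes k ⟫ (δ a c) _) ⟩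
  ∑ ⟪ prefixes k ⟫ (λ (p , r) → δ a c * (δL x p * δL y r))
    ≡⟨ ∑-cong ⟪ prefixes k ⟫ (λ (p , r) → sym (*-assoc (δ a c) (δL x p) (δL y r))) ⟩
  S ≡⟨ sym (+-identityˡ S) ⟩
  0ℚ + S
    ≡⟨ cong (_+ S) (sym (*-zeroˡ (δL y (c ∷ k)))) ⟩
  0ℚ * δL y (c ∷ k) + S
    ≡⟨ sym (∑-prefixes-∷ c k _) ⟩
  _ ∎
  where
  S : ℚ
  S = ∑ ⟪ prefixes k ⟫ (λ (p , r) → δ a c * δL x p * δL y r)

∑-product : (L : Lin X) (M : Lin Y) (f : X → ℚ) (g : Y → ℚ) →
  ∑ L (λ x → ∑ M (λ y → f x * g y)) ≡ ∑ L f * ∑ M g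
∑-product L M f g = trans (∑-cong L (λ x → ∑-*ˡ M (f x) g)) (∑-*ʳ L (∑ M g) f)

∑-mulL-δL : (L M : Lin (List ℕ)) (k : List ℕ) →
  ∑ (mulL L M) (λ w → δL w k) ≡
  ∑ ⟪ prefixes k ⟫ (λ (p , r) → ∑ L (λ u → δL u p) * ∑ M (λ v → δL v r))
∑-mulL-δL L M k = begin
  _ ≡⟨ ∑-mulL L M _ ⟩
  _ ≡⟨ ∑-cong L (λ u → ∑-cong M (λ v → δL-++ u v k)) ⟩
  _ ≡⟨ ∑-cong L (λ u → ∑-swap M ⟪ prefixes k ⟫ _) ⟩
  _ ≡⟨ ∑-swap L ⟪ prefixes k ⟫ _ ⟩
  _ ≡⟨ ∑-cong ⟪ prefixes k ⟫ (λ (p , r) → ∑-product L M (λ u → δL u p) (λ v → δL v r)) ⟩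
  _ ∎

private
  ∑-desh-left : ∀ v u → ∑ ⟪ desh u ⟫ (λ (a , b) → δL [] a * δL v b) ≡ δL v u
  ∑-desh-left v [] = trans (∑-single ([] , []) _) (*-identityˡ (δL v []))
  ∑-desh-left v (x ∷ u) = trans (∑-desh-∷ x u _) (trans
    (∑-cong ⟪ desh u ⟫ (λ (a , b) → trans (cong (_+ δL [] a * δL v (x ∷ b)) (*-zeroˡ (δL v b))) (+-identityˡ _)))
    (rest v))
    where
    rest : ∀ v → ∑ ⟪ desh u ⟫ (λ (a , b) → δL [] a * δL v (x ∷ b)) ≡ δL v (x ∷ u)
    rest [] = ∑-zero ⟪ desh u ⟫ (λ (a , b) → *-zeroʳ (δL [] a))
    rest (y ∷ v) = trans
      (∑-cong ⟪ desh u ⟫ (λ (a , b) → solve 3 (λ p q r → p :* (q :* r) := q :* (p :* r)) refl (δL [] a) (δ y x) (δL v b)))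
      (trans (∑-*ˡ ⟪ desh u ⟫ (δ y x) _) (cong (δ y x *_) (∑-desh-left v u)))

  ∑-desh-right : ∀ v u → ∑ ⟪ desh u ⟫ (λ (a , b) → δL v a * δL [] b) ≡ δL v u
  ∑-desh-right v [] = trans (∑-single ([] , []) _) (*-identityʳ (δL v []))
  ∑-desh-right v (x ∷ u) = trans (∑-desh-∷ x u _) (trans
    (∑-cong ⟪ desh u ⟫ (λ (a , b) → trans (cong (δL v (x ∷ a) * δL [] b +_) (*-zeroʳ (δL v a))) (+-identityʳ _)))
    (rest v))
    where
    rest : ∀ v → ∑ ⟪ desh u ⟫ (λ (a , b) → δL v (x ∷ a) * δL [] b) ≡ δL v (x ∷ u)
    rest [] = ∑-zero ⟪ desh u ⟫ (λ (a , b) → *-zeroˡ (δL [] b))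
    rest (y ∷ v) = trans
      (∑-cong ⟪ desh u ⟫ (λ (a , b) → *-assoc (δ y x) (δL v a) (δL [] b)))
      (trans (∑-*ˡ ⟪ desh u ⟫ (δ y x) _) (cong (δ y x *_) (∑-desh-right v u)))

-- The first letter of a shuffle comes from exactly one of the two factors, which is the choice
-- `desh` makes for the first letter of u. The cases with an empty factor are the counit property of
-- Δ.
∑-sh : ∀ p v u → ∑ (sh p v) (λ w → δL w u) ≡ ∑ ⟪ desh u ⟫ (λ (a , b) → δL p a * δL v b)
∑-sh [] v u = trans (∑-single v _) (sym (∑-desh-left v u))
∑-sh (x ∷ p) [] u = trans (∑-single (x ∷ p) _) (sym (∑-desh-right (x ∷ p) u))
∑-sh (x ∷ p) (y ∷ v) u = trans (∑-++ (mapL (x ∷_) (sh p (y ∷ v))) _ _)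
  (trans (cong₂ _+_ (∑-mapL (x ∷_) (sh p (y ∷ v)) _) (∑-mapL (y ∷_) (sh (x ∷ p) v) _)) (step u))
  where
  step : ∀ u → ∑ (sh p (y ∷ v)) (λ w → δL (x ∷ w) u) + ∑ (sh (x ∷ p) v) (λ w → δL (y ∷ w) u) ≡
    ∑ ⟪ desh u ⟫ (λ (a , b) → δL (x ∷ p) a * δL (y ∷ v) b)
  step [] = trans (cong₂ _+_ (∑-0 (sh p (y ∷ v))) (∑-0 (sh (x ∷ p) v))) (sym (∑-single ([] , []) _))
  step (z ∷ u) = begin
    _ ≡⟨ cong₂ _+_ (trans (∑-*ˡ (sh p (y ∷ v)) (δ x z) _) (cong (δ x z *_) (∑-sh p (y ∷ v) u)))
                   (trans (∑-*ˡ (sh (x ∷ p) v) (δ y z) _) (cong (δ y z *_) (∑-sh (x ∷ p) v u))) ⟩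
    _ ≡⟨ cong₂ _+_ (sym (∑-*ˡ ⟪ desh u ⟫ (δ x z) _)) (sym (∑-*ˡ ⟪ desh u ⟫ (δ y z) _)) ⟩
    _ ≡⟨ sym (∑-+ ⟪ desh u ⟫ _ _) ⟩
    _ ≡⟨ ∑-cong ⟪ desh u ⟫ (λ (a , b) →
           solve 6 (λ xz yz pa vb xpa yvb → xz :* (pa :* yvb) :+ yz :* (xpa :* vb) := xz :* pa :* yvb :+ xpa :* (yz :* vb)) refl
             (δ x z) (δ y z) (δL p a) (δL v b) (δL (x ∷ p) a) (δL (y ∷ v) b)) ⟩
    _ ≡⟨ sym (∑-desh-∷ z u _) ⟩
    _ ∎

-- Words with a marked letter, and chains of marked blocks

marks : List ℕ → List Block
marks [] = []
marks (x ∷ p) = ([] , x , p) ∷ map (λ (b , c , a) → x ∷ b , c , a) (marks p)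

∑-marks-∷ : (x : ℕ) (p : List ℕ) (f : Block → ℚ) →
  ∑ ⟪ marks (x ∷ p) ⟫ f ≡ f ([] , x , p) + ∑ ⟪ marks p ⟫ (λ (b , c , a) → f (x ∷ b , c , a))
∑-marks-∷ x p f = trans (∑-⟪∷⟫ _ _ f) (cong (f ([] , x , p) +_) (∑-⟪map⟫ _ (marks p) f))

δL-marks : ∀ x c y p → δL (x ++ c ∷ y) p ≡ ∑ ⟪ marks p ⟫ (λ (b , c' , a) → δL x b * (δ c c' * δL y a))
δL-marks [] c y [] = sym (∑-[] _)
δL-marks (z ∷ x) c y [] = sym (∑-[] _)
δL-marks [] c y (q ∷ p) = sym (trans (∑-marks-∷ q p _) (trans
  (cong₂ _+_ (*-identityˡ (δ c q * δL y p)) (∑-zero ⟪ marks p ⟫ (λ (b , c' , a) → *-zeroˡ (δ c c' * δL y a))))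
  (+-identityʳ (δ c q * δL y p))))
δL-marks (z ∷ x) c y (q ∷ p) = begin
  δ z q * δL (x ++ c ∷ y) p
    ≡⟨ cong (δ z q *_) (δL-marks x c y p) ⟩
  _ ≡⟨ sym (∑-*ˡ ⟪ marks p ⟫ (δ z q) _) ⟩
  _ ≡⟨ ∑-cong ⟪ marks p ⟫ (λ (b , c' , a) → sym (*-assoc (δ z q) (δL x b) (δ c c' * δL y a))) ⟩
  S ≡⟨ sym (+-identityˡ S) ⟩
  0ℚ + S
    ≡⟨ cong (_+ S) (sym (*-zeroˡ (δ c q * δL y p))) ⟩
  0ℚ * (δ c q * δL y p) + S
    ≡⟨ sym (∑-marks-∷ q p _) ⟩
  _ ∎
  where
  S : ℚ
  S = ∑ ⟪ marks p ⟫ (λ (b , c' , a) → δ z q * δL x b * (δ c c' * δL y a))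

∑-goAfter : ∀ b c a xs (f : List Block → ℚ) →
  ∑ ⟪ goAfter b c a xs ⟫ f ≡
  ∑ ⟪ prefixes xs ⟫ (λ (p , r) → ∑ ⟪ markedBlocks r ⟫ (λ βs → f ((b , c , a ++ p) ∷ βs)))
∑-goAfter b c a [] f = trans (∑-single _ f) (sym (trans (∑-single ([] , []) _)
  (trans (∑-single [] _) (cong (λ a → f ((b , c , a) ∷ [])) (LP.++-identityʳ a)))))
∑-goAfter b c a (x ∷ xs) f = begin
  ∑ ⟪ goAfter b c a (x ∷ xs) ⟫ f
    -- Either the block continues past x, or it stops at the empty prefix and what follows is
    -- `markedBlocks (x ∷ xs)` by computation.
    ≡⟨ ∑-⟪++⟫ (goAfter b c (a ++ x ∷ []) xs) _ f ⟩
  ∑ ⟪ goAfter b c (a ++ x ∷ []) xs ⟫ f + ∑ ⟪ map ((b , c , a) ∷_) (markedBlocks (x ∷ xs)) ⟫ f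
    ≡⟨ cong₂ _+_
         (trans (∑-goAfter b c (a ++ x ∷ []) xs f) (∑-cong ⟪ prefixes xs ⟫ (λ (p , r) →
           ∑-cong ⟪ markedBlocks r ⟫ (λ βs → cong (λ a → f ((b , c , a) ∷ βs)) (LP.++-assoc a (x ∷ []) p)))))
         (trans (∑-⟪map⟫ _ (markedBlocks (x ∷ xs)) f) (∑-cong ⟪ markedBlocks (x ∷ xs) ⟫ (λ βs →
           cong (λ a → f ((b , c , a) ∷ βs)) (sym (LP.++-identityʳ a))))) ⟩
  _ ≡⟨ +-comm (∑ ⟪ prefixes xs ⟫ (λ (p , r) → ∑ ⟪ markedBlocks r ⟫ (λ βs → f ((b , c , a ++ x ∷ p) ∷ βs)))) _ ⟩
  _ ≡⟨ sym (∑-prefixes-∷ x xs _) ⟩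
  _ ∎

-- `goBefore` and `goAfter` interleave the choices of j and of the end of the block. Here they are
-- separated: cutting off a prefix p dualises a product of words, marking a letter of p dualises a
-- single action on a letter.
∑-goBefore : ∀ b xs (f : List Block → ℚ) →
  ∑ ⟪ goBefore b xs ⟫ f ≡
  ∑ ⟪ prefixes xs ⟫ (λ (p , r) → ∑ ⟪ marks p ⟫ (λ (b' , c , a) → ∑ ⟪ markedBlocks r ⟫ (λ βs → f ((b ++ b' , c , a) ∷ βs))))
∑-goBefore b [] f = trans (∑-[] f) (sym (trans (∑-single ([] , []) _) (∑-[] _)))
∑-goBefore b (x ∷ xs) f = begin
  ∑ ⟪ goBefore b (x ∷ xs) ⟫ f
    ≡⟨ ∑-⟪++⟫ (goBefore (b ++ x ∷ []) xs) _ f ⟩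
  ∑ ⟪ goBefore (b ++ x ∷ []) xs ⟫ f + ∑ ⟪ goAfter b x [] xs ⟫ f
    ≡⟨ cong₂ _+_
         (trans (∑-goBefore (b ++ x ∷ []) xs f) (∑-cong ⟪ prefixes xs ⟫ (λ (p , r) → ∑-cong ⟪ marks p ⟫ (λ (b' , c , a) →
           ∑-cong ⟪ markedBlocks r ⟫ (λ βs → cong (λ z → f ((z , c , a) ∷ βs)) (LP.++-assoc b (x ∷ []) b'))))))
         (trans (∑-goAfter b x [] xs f) (∑-cong ⟪ prefixes xs ⟫ (λ (p , r) →
           ∑-cong ⟪ markedBlocks r ⟫ (λ βs → cong (λ z → f ((z , x , p) ∷ βs)) (sym (LP.++-identityʳ b)))))) ⟩
  _ ≡⟨ +-comm (∑ ⟪ prefixes xs ⟫ (λ (p , r) → ∑ ⟪ marks p ⟫ (λ (b' , c , a) → ∑ ⟪ markedBlocks r ⟫ (λ βs → f ((b ++ x ∷ b' , c , a) ∷ βs))))) _ ⟩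
  _ ≡⟨ sym (∑-+ ⟪ prefixes xs ⟫ _ _) ⟩
  _ ≡⟨ ∑-cong ⟪ prefixes xs ⟫ (λ (p , r) → sym (∑-marks-∷ x p _)) ⟩
  S ≡⟨ sym (+-identityˡ S) ⟩
  0ℚ + S
    ≡⟨ cong (_+ S) (sym (∑-[] _)) ⟩
  _ ≡⟨ sym (∑-prefixes-∷ x xs _) ⟩
  _ ∎
  where
  S : ℚ
  S = ∑ ⟪ prefixes xs ⟫ (λ (p , r) → ∑ ⟪ marks (x ∷ p) ⟫ (λ (b' , c , a) → ∑ ⟪ markedBlocks r ⟫ (λ βs → f ((b ++ b' , c , a) ∷ βs))))

-- The contribution of a single block

-- Lowering works letter by letter and drops add, so it does not matter whether the letters are
-- distributed over the two tensor factors before or after.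
∑-lowerWord-desh : (u : List ℕ) (F : ℕ → List ℕ → List ℕ → ℚ) →
  ∑ (lowerWord u) (λ (d , l) → ∑ ⟪ desh l ⟫ (λ (x , y) → F d x y)) ≡
  ∑ ⟪ desh u ⟫ (λ (u₁ , u₂) → ∑ (lowerWord u₁) (λ (d , x) → ∑ (lowerWord u₂) (λ (e , y) → F (d +ⁿ e) x y)))
∑-lowerWord-desh [] F = begin
  _ ≡⟨ trans (∑-single (0 , []) _) (∑-single ([] , []) _) ⟩
  F 0 [] []
    ≡⟨ sym (trans (∑-single ([] , []) _) (trans (∑-single (0 , []) _) (∑-single (0 , []) _))) ⟩
  _ ∎
∑-lowerWord-desh (k ∷ u) F = begin
  _ ≡⟨ ∑-lowerWord-∷ k u _ ⟩
  _ ≡⟨ ∑-cong (lowerLetter k) (λ (c , z) → trans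
         (∑-cong (lowerWord u) (λ (d , l) → ∑-desh-∷ z l _))
         (∑-lowerWord-desh u (λ d x y → F (c +ⁿ d) (z ∷ x) y + F (c +ⁿ d) x (z ∷ y)))) ⟩
  _ ≡⟨ ∑-swap (lowerLetter k) ⟪ desh u ⟫ _ ⟩
  _ ≡⟨ ∑-cong ⟪ desh u ⟫ (λ (u₁ , u₂) → trans
         (∑-cong (lowerLetter k) (λ (c , z) → trans
           (∑-cong (lowerWord u₁) (λ (d , x) → ∑-+ (lowerWord u₂) _ _)) (∑-+ (lowerWord u₁) _ _)))
         (trans (∑-+ (lowerLetter k) _ _) (cong₂ _+_ (left u₁ u₂) (right u₁ u₂)))) ⟩
  _ ≡⟨ sym (∑-desh-∷ k u _) ⟩
  _ ∎
  where
  left : ∀ u₁ u₂ →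
    ∑ (lowerLetter k) (λ (c , z) → ∑ (lowerWord u₁) (λ (d , x) → ∑ (lowerWord u₂) (λ (e , y) → F (c +ⁿ (d +ⁿ e)) (z ∷ x) y))) ≡
    ∑ (lowerWord (k ∷ u₁)) (λ (d , x) → ∑ (lowerWord u₂) (λ (e , y) → F (d +ⁿ e) x y))
  left u₁ u₂ = begin
    _ ≡⟨ ∑-cong (lowerLetter k) (λ (c , z) → ∑-cong (lowerWord u₁) (λ (d , x) → ∑-cong (lowerWord u₂) (λ (e , y) →
           cong (λ m → F m (z ∷ x) y) (sym (ℕP.+-assoc c d e))))) ⟩
    _ ≡⟨ sym (∑-lowerWord-∷ k u₁ _) ⟩
    _ ∎
  right : ∀ u₁ u₂ →
    ∑ (lowerLetter k) (λ (c , z) → ∑ (lowerWord u₁) (λ (d , x) → ∑ (lowerWord u₂) (λ (e , y) → F (c +ⁿ (d +ⁿ e)) x (z ∷ y)))) ≡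
    ∑ (lowerWord u₁) (λ (d , x) → ∑ (lowerWord (k ∷ u₂)) (λ (e , y) → F (d +ⁿ e) x y))
  right u₁ u₂ = begin
    _ ≡⟨ ∑-swap (lowerLetter k) (lowerWord u₁) _ ⟩
    _ ≡⟨ ∑-cong (lowerWord u₁) (λ (d , x) → trans
           (∑-cong (lowerLetter k) (λ (c , z) → ∑-cong (lowerWord u₂) (λ (e , y) →
             cong (λ m → F m x (z ∷ y)) (x∙yz≈y∙xz c d e))))
           (sym (∑-lowerWord-∷ k u₂ _))) ⟩
    _ ∎
    where open import Algebra.Properties.CommutativeSemigroup ℕP.+-commutativeSemigroup using (x∙yz≈y∙xz)

∑-lowerWord-++ : (u v : List ℕ) (F : ℕ → List ℕ → ℚ) →
  ∑ (lowerWord (u ++ v)) (λ (d , l) → F d l) ≡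
  ∑ (lowerWord u) (λ (d , x) → ∑ (lowerWord v) (λ (e , y) → F (d +ⁿ e) (x ++ y)))
∑-lowerWord-++ [] v F = sym (∑-single (0 , []) _)
∑-lowerWord-++ (k ∷ u) v F = begin
  _ ≡⟨ ∑-lowerWord-∷ k (u ++ v) _ ⟩
  _ ≡⟨ ∑-cong (lowerLetter k) (λ (c , z) → trans
         (∑-lowerWord-++ u v (λ d l → F (c +ⁿ d) (z ∷ l)))
         (∑-cong (lowerWord u) (λ (d , x) → ∑-cong (lowerWord v) (λ (e , y) →
           cong (λ m → F m (z ∷ x ++ y)) (sym (ℕP.+-assoc c d e)))))) ⟩
  _ ≡⟨ sym (∑-lowerWord-∷ k u _) ⟩
  _ ∎

∑-lowerWord-reverse : (u : List ℕ) (F : ℕ → List ℕ → ℚ) →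
  ∑ (lowerWord u) (λ (d , l) → F d (reverse l)) ≡ ∑ (lowerWord (reverse u)) (λ (d , l) → F d l)
∑-lowerWord-reverse [] F = trans (∑-single (0 , []) _) (sym (∑-single (0 , []) _))
∑-lowerWord-reverse (k ∷ u) F = begin
  _ ≡⟨ ∑-lowerWord-∷ k u _ ⟩
  _ ≡⟨ ∑-swap (lowerLetter k) (lowerWord u) _ ⟩
  _ ≡⟨ ∑-cong (lowerWord u) (λ (d , l) → ∑-cong (lowerLetter k) (λ (c , z) →
         cong₂ F (ℕP.+-comm c d) (LP.unfold-reverse z l))) ⟩
  _ ≡⟨ ∑-lowerWord-reverse u (λ d l → ∑ (lowerLetter k) (λ (c , z) → F (d +ⁿ c) (l ++ z ∷ []))) ⟩
  _ ≡⟨ ∑-cong (lowerWord (reverse u)) (λ (d , l) → sym (trans (∑-lowerWord-∷ k [] _)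
         (∑-cong (lowerLetter k) (λ (c , z) → trans (∑-single (0 , []) _)
           (cong (λ m → F (d +ⁿ m) (l ++ z ∷ [])) (ℕP.+-identityʳ c)))))) ⟩
  _ ≡⟨ sym (∑-lowerWord-++ (reverse u) (k ∷ []) F) ⟩
  _ ≡⟨ ∑-congˡ (cong lowerWord (sym (LP.unfold-reverse k u))) ⟩
  _ ∎

-- Transposing the lowering: from lowered words to bounded tuples

∑-upTo-δ-≥ : ∀ n z (f : ℕ → ℚ) → n ≤ z → ∑ ⟪ upTo n ⟫ (λ j → δ j z * f j) ≡ 0ℚ
∑-upTo-δ-≥ zero z f _ = ∑-[] _
∑-upTo-δ-≥ (suc n) (suc z) f (s≤s n≤z) = trans (∑-upTo-suc n _)
  (trans (cong₂ _+_ (*-zeroˡ (f 0)) (∑-upTo-δ-≥ n z (f ∘ suc) n≤z)) (+-identityˡ 0ℚ))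

∑-upTo-δ : ∀ n z (f : ℕ → ℚ) → z < n → ∑ ⟪ upTo n ⟫ (λ j → δ j z * f j) ≡ f z
∑-upTo-δ (suc n) zero f _ = trans (∑-upTo-suc n _)
  (trans (cong₂ _+_ (*-identityˡ (f 0)) (∑-zero ⟪ upTo n ⟫ (λ j → *-zeroˡ (f (suc j))))) (+-identityʳ (f 0)))
∑-upTo-δ (suc n) (suc z) f (s≤s z<n) = trans (∑-upTo-suc n _)
  (trans (cong₂ _+_ (*-zeroˡ (f 0)) (∑-upTo-δ n z (f ∘ suc) z<n)) (+-identityˡ (f (suc z))))

-- With the lowered letter z prescribed, the source is z + a, where a is the drop. The vanishing of
-- `f` beyond `N` allows a to range over a set independent of the source y.
∑-lowerLetter-δ : (z y N : ℕ) (f : ℕ → ℚ) → (∀ d → N < d → f d ≡ 0ℚ) →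
  ∑ (lowerLetter y) (λ (d , x) → δ x z * f d) ≡ ∑ ⟪ upTo (suc N) ⟫ (λ a → δ (z +ⁿ a) y * (ari (z +ⁿ a) z * f a))
∑-lowerLetter-δ z y N f vanish with z ℕ.≤? y
... | no z≰y = trans
  (trans (∑-lowerLetter y _) (trans
    (∑-cong ⟪ upTo (suc y) ⟫ (λ x → solve 3 (λ p q r → p :* (q :* r) := q :* (p :* r)) refl (ari y x) (δ x z) (f (y ∸ x))))
    (∑-upTo-δ-≥ (suc y) z (λ x → ari y x * f (y ∸ x)) (ℕP.≰⇒> z≰y))))
  (sym (∑-zero ⟪ upTo (suc N) ⟫ (λ a → trans
    (cong (_* (ari (z +ⁿ a) z * f a)) (δ-≢ {z +ⁿ a} {y} (λ { refl → z≰y (ℕP.m≤m+n z a) }))) (*-zeroˡ (ari (z +ⁿ a) z * f a)))))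
... | yes z≤y = begin
  _ ≡⟨ ∑-lowerLetter y _ ⟩
  ∑ ⟪ upTo (suc y) ⟫ (λ x → ari y x * (δ x z * f (y ∸ x)))
    ≡⟨ ∑-cong ⟪ upTo (suc y) ⟫ (λ x → solve 3 (λ p q r → p :* (q :* r) := q :* (p :* r)) refl (ari y x) (δ x z) (f (y ∸ x))) ⟩
  ∑ ⟪ upTo (suc y) ⟫ (λ x → δ x z * (ari y x * f (y ∸ x)))
    ≡⟨ ∑-upTo-δ (suc y) z _ (s≤s z≤y) ⟩
  ari y z * f (y ∸ z)
    ≡⟨ cong (λ m → ari m z * f (y ∸ z)) (sym (ℕP.m+[n∸m]≡n z≤y)) ⟩
  g (y ∸ z)
    ≡⟨ sym pick ⟩
  ∑ ⟪ upTo (suc N) ⟫ (λ a → δ a (y ∸ z) * g a)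
    ≡⟨ ∑-cong ⟪ upTo (suc N) ⟫ (λ a → cong (_* g a) (δ-cong {a} {y ∸ z}
         (λ e → trans (cong (z +ⁿ_) e) (ℕP.m+[n∸m]≡n z≤y))
         (λ e → trans (sym (ℕP.m+n∸m≡n z a)) (cong (_∸ z) e)))) ⟩
  _ ∎
  where
  g : ℕ → ℚ
  g a = ari (z +ⁿ a) z * f a
  pick : ∑ ⟪ upTo (suc N) ⟫ (λ a → δ a (y ∸ z) * g a) ≡ g (y ∸ z)
  pick with y ∸ z ℕ.≤? N
  ... | yes e≤N = ∑-upTo-δ (suc N) (y ∸ z) g (s≤s e≤N)
  ... | no e≰N = trans (∑-upTo-δ-≥ (suc N) (y ∸ z) g (ℕP.≰⇒> e≰N))
    (sym (trans (cong (ari (z +ⁿ (y ∸ z)) z *_) (vanish (y ∸ z) (ℕP.≰⇒> e≰N))) (*-zeroʳ (ari (z +ⁿ (y ∸ z)) z))))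

∑-bnd-suc : ∀ r N (f : List ℕ → ℚ) →
  ∑ ⟪ bnd (suc r) N ⟫ f ≡ ∑ ⟪ upTo (suc N) ⟫ (λ a → ∑ ⟪ bnd r (N ∸ a) ⟫ (λ l → f (a ∷ l)))
∑-bnd-suc r N f = trans (∑-⟪concatMap⟫ (λ a → map (a ∷_) (bnd r (N ∸ a))) (upTo (suc N)) f)
  (∑-cong ⟪ upTo (suc N) ⟫ (λ a → ∑-⟪map⟫ (a ∷_) (bnd r (N ∸ a)) f))

∑-bnd-cong : ∀ r N {f g : List ℕ → ℚ} → (∀ l → length l ≡ r → sum l ≤ N → f l ≡ g l) →
  ∑ ⟪ bnd r N ⟫ f ≡ ∑ ⟪ bnd r N ⟫ g
∑-bnd-cong zero N {f} {g} h = trans (∑-single [] f) (trans (h [] refl z≤n) (sym (∑-single [] g)))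
∑-bnd-cong (suc r) N {f} {g} h = trans (∑-bnd-suc r N f) (trans
  (∑-upTo-cong (suc N) (λ { a (s≤s a≤N) → ∑-bnd-cong r (N ∸ a) (λ l len l≤ →
    h (a ∷ l) (cong suc len) (subst (a +ⁿ sum l ≤_) (ℕP.m+[n∸m]≡n a≤N) (ℕP.+-monoʳ-≤ a l≤))) }))
  (sym (∑-bnd-suc r N g)))

δ-∸ : ∀ {a N} m → a ≤ N → δ (a +ⁿ m) N ≡ δ m (N ∸ a)
δ-∸ {a} {N} m a≤N = δ-cong {a +ⁿ m} {N}
  (λ e → trans (sym (ℕP.m+n∸m≡n a m)) (cong (_∸ a) e))
  (λ e → trans (cong (a +ⁿ_) e) (ℕP.m+[n∸m]≡n a≤N))

-- Adds one letter to a lowering whose transpose is known. The condition that the total drop plus s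
-- be N bounds the new drop by N and leaves N ∸ a for the others, just as in `bnd`. `L`, `w` and
-- `drop` are abstract so that one word and a pair of words share the step.
∑-bnd-step : (L : Lin X) (w : X → ℚ) (drop : X → ℕ) (r s : ℕ) (m : List ℕ → ℚ) →
  (∀ N → ∑ L (λ p → w p * δ (drop p +ⁿ s) N) ≡ ∑ ⟪ bnd r N ⟫ (λ l → m l * δ (sum l +ⁿ s) N)) →
  (z y N : ℕ) →
  ∑ (lowerLetter y) (λ (d , x) → ∑ L (λ p → δ x z * w p * δ (d +ⁿ drop p +ⁿ s) N)) ≡
  ∑ ⟪ upTo (suc N) ⟫ (λ a → ∑ ⟪ bnd r (N ∸ a) ⟫ (λ l → ari (z +ⁿ a) z * (δ (z +ⁿ a) y * m l) * δ (a +ⁿ sum l +ⁿ s) N))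
∑-bnd-step L w drop r s m IH z y N = begin
  _ ≡⟨ ∑-cong (lowerLetter y) (λ (d , x) → trans
         (∑-cong L (λ p → *-assoc (δ x z) (w p) (δ (d +ⁿ drop p +ⁿ s) N)))
         (∑-*ˡ L (δ x z) _)) ⟩
  ∑ (lowerLetter y) (λ (d , x) → δ x z * F d)
    ≡⟨ ∑-lowerLetter-δ z y N F F-vanish ⟩
  ∑ ⟪ upTo (suc N) ⟫ (λ a → δ (z +ⁿ a) y * (ari (z +ⁿ a) z * F a))
    ≡⟨ ∑-upTo-cong (suc N) (λ { a (s≤s a≤N) → trans
         (cong (λ q → δ (z +ⁿ a) y * (ari (z +ⁿ a) z * q)) (F-bnd a a≤N))
         (trans (cong (δ (z +ⁿ a) y *_) (sym (∑-*ˡ ⟪ bnd r (N ∸ a) ⟫ (ari (z +ⁿ a) z) _))) (trans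
         (sym (∑-*ˡ ⟪ bnd r (N ∸ a) ⟫ (δ (z +ⁿ a) y) _))
         (∑-cong ⟪ bnd r (N ∸ a) ⟫ (λ l →
           solve 4 (λ p q c t → p :* (q :* (c :* t)) := q :* (p :* c) :* t) refl
             (δ (z +ⁿ a) y) (ari (z +ⁿ a) z) (m l) (δ (a +ⁿ sum l +ⁿ s) N))))) }) ⟩
  _ ∎
  where
  F : ℕ → ℚ
  F d = ∑ L (λ p → w p * δ (d +ⁿ drop p +ⁿ s) N)
  F-vanish : ∀ d → N < d → F d ≡ 0ℚ
  F-vanish d N<d = ∑-zero L (λ p → trans
    (cong (w p *_) (δ-≢ (λ e → ℕP.<⇒≱ N<d (subst (d ≤_) (trans (sym (ℕP.+-assoc d (drop p) s)) e) (ℕP.m≤m+n d (drop p +ⁿ s))))))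
    (*-zeroʳ (w p)))
  δ-shift : ∀ {a} k → a ≤ N → δ (a +ⁿ k +ⁿ s) N ≡ δ (k +ⁿ s) (N ∸ a)
  δ-shift {a} k a≤N = trans (cong (λ q → δ q N) (ℕP.+-assoc a k s)) (δ-∸ (k +ⁿ s) a≤N)
  F-bnd : ∀ a → a ≤ N → F a ≡ ∑ ⟪ bnd r (N ∸ a) ⟫ (λ l → m l * δ (a +ⁿ sum l +ⁿ s) N)
  F-bnd a a≤N = begin
    F a ≡⟨ ∑-cong L (λ p → cong (w p *_) (δ-shift (drop p) a≤N)) ⟩
    _ ≡⟨ IH (N ∸ a) ⟩
    _ ≡⟨ ∑-cong ⟪ bnd r (N ∸ a) ⟫ (λ l → cong (m l *_) (sym (δ-shift (sum l) a≤N))) ⟩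
    _ ∎

-- Packs two lowerings into one combination, the form that `∑-bnd-step` takes.
pairL : Lin X → Lin Y → Lin (X × Y)
pairL L M = bindL L (λ x → mapL (x ,_) M)

∑-pairL : (L : Lin X) (M : Lin Y) (f : X × Y → ℚ) → ∑ (pairL L M) f ≡ ∑ L (λ x → ∑ M (λ y → f (x , y)))
∑-pairL L M f = trans (∑-bindL L _ f) (∑-cong L (λ x → ∑-mapL _ M f))

-- Lowering y to z is raising z by l to y; this is where the multiplicity of z + l over z arises.
∑-bnd-word : (z y : List ℕ) (s N : ℕ) →
  ∑ (lowerWord y) (λ (d , x) → δL x z * δ (d +ⁿ s) N) ≡
  ∑ ⟪ bnd (length z) N ⟫ (λ l → mult (zipWith _+ⁿ_ z l) z * δL (zipWith _+ⁿ_ z l) y * δ (sum l +ⁿ s) N)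
∑-bnd-word [] [] s N = trans (∑-single (0 , []) _) (sym (∑-single [] _))
∑-bnd-word [] (y ∷ ys) s N = trans
  (trans (∑-lowerWord-∷ y ys _) (∑-zero (lowerLetter y) (λ (c , x₀) → ∑-zero (lowerWord ys) (λ (d , x) → *-zeroˡ (δ (c +ⁿ d +ⁿ s) N)))))
  (sym (trans (∑-single [] _) (*-zeroˡ (δ s N))))
∑-bnd-word (z ∷ zs) [] s N = trans (trans (∑-single (0 , []) _) (*-zeroˡ (δ s N)))
  (sym (trans (∑-bnd-suc (length zs) N _) (∑-zero ⟪ upTo (suc N) ⟫ (λ a → ∑-zero ⟪ bnd (length zs) (N ∸ a) ⟫ (λ l →
    solve 2 (λ p q → p :* con 0ℚ :* q := con 0ℚ) refl (mult (zipWith _+ⁿ_ (z ∷ zs) (a ∷ l)) (z ∷ zs)) (δ (a +ⁿ sum l +ⁿ s) N))))))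
∑-bnd-word (z ∷ zs) (y ∷ ys) s N = begin
  _ ≡⟨ ∑-lowerWord-∷ y ys _ ⟩
  _ ≡⟨ ∑-bnd-step (lowerWord ys) (λ (d , x) → δL x zs) proj₁ (length zs) s _ (∑-bnd-word zs ys s) z y N ⟩
  _ ≡⟨ ∑-cong ⟪ upTo (suc N) ⟫ (λ a → ∑-cong ⟪ bnd (length zs) (N ∸ a) ⟫ (λ l → cong (_* δ (a +ⁿ sum l +ⁿ s) N) (begin
         ari (z +ⁿ a) z * (δ (z +ⁿ a) y * (mult (zipWith _+ⁿ_ zs l) zs * δL (zipWith _+ⁿ_ zs l) ys))
           ≡⟨ solve 4 (λ p q m t → p :* (q :* (m :* t)) := p :* m :* (q :* t)) refl
                (ari (z +ⁿ a) z) (δ (z +ⁿ a) y) (mult (zipWith _+ⁿ_ zs l) zs) (δL (zipWith _+ⁿ_ zs l) ys) ⟩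
         ari (z +ⁿ a) z * mult (zipWith _+ⁿ_ zs l) zs * (δ (z +ⁿ a) y * δL (zipWith _+ⁿ_ zs l) ys)
           ≡⟨ cong (_* (δ (z +ⁿ a) y * δL (zipWith _+ⁿ_ zs l) ys)) (sym (mult-∷ (z +ⁿ a) (zipWith _+ⁿ_ zs l) z zs)) ⟩
         _ ∎))) ⟩
  _ ≡⟨ sym (∑-bnd-suc (length zs) N _) ⟩
  _ ∎

-- The letters before and after the mark share a single bound on |l|, so both words have to be
-- transposed together.
∑-bnd-words : (b a v u : List ℕ) (s N : ℕ) →
  ∑ (pairL (lowerWord v) (lowerWord u)) (λ ((d , x) , (e , y)) → δL x b * δL y a * δ (d +ⁿ e +ⁿ s) N) ≡
  ∑ ⟪ bnd (length b +ⁿ length a) N ⟫ (λ l → mult (zipWith _+ⁿ_ (b ++ a) l) (b ++ a) *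
    (δL (zipWith _+ⁿ_ b (take (length b) l)) v * δL (zipWith _+ⁿ_ a (drop (length b) l)) u) * δ (sum l +ⁿ s) N)
∑-bnd-words [] a [] u s N = begin
  _ ≡⟨ trans (∑-pairL (lowerWord []) (lowerWord u) _) (∑-single (0 , []) _) ⟩
  _ ≡⟨ ∑-cong (lowerWord u) (λ (e , y) → cong (_* δ (e +ⁿ s) N) (*-identityˡ (δL y a))) ⟩
  _ ≡⟨ ∑-bnd-word a u s N ⟩
  _ ≡⟨ ∑-cong ⟪ bnd (length a) N ⟫ (λ l → cong (λ q → mult (zipWith _+ⁿ_ a l) a * q * δ (sum l +ⁿ s) N)
         (sym (*-identityˡ (δL (zipWith _+ⁿ_ a l) u)))) ⟩
  _ ∎
∑-bnd-words [] a (y ∷ ys) u s N = trans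
  (trans (∑-pairL (lowerWord (y ∷ ys)) (lowerWord u) _) (trans (∑-lowerWord-∷ y ys _)
    (∑-zero (lowerLetter y) (λ (c , x₀) → ∑-zero (lowerWord ys) (λ (d , x) → ∑-zero (lowerWord u) (λ (e , y') →
      solve 2 (λ p q → con 0ℚ :* p :* q := con 0ℚ) refl (δL y' a) (δ (c +ⁿ d +ⁿ e +ⁿ s) N)))))))
  (sym (∑-zero ⟪ bnd (length a) N ⟫ (λ l →
    solve 3 (λ m p q → m :* (con 0ℚ :* p) :* q := con 0ℚ) refl (mult (zipWith _+ⁿ_ a l) a) (δL (zipWith _+ⁿ_ a l) u) (δ (sum l +ⁿ s) N))))
∑-bnd-words (z ∷ b) a [] u s N = trans
  (trans (∑-pairL (lowerWord []) (lowerWord u) _) (trans (∑-single (0 , []) _) (∑-zero (lowerWord u) (λ (e , y) →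
    solve 2 (λ p q → con 0ℚ :* p :* q := con 0ℚ) refl (δL y a) (δ (e +ⁿ s) N)))))
  (sym (trans (∑-bnd-suc (length b +ⁿ length a) N _) (∑-zero ⟪ upTo (suc N) ⟫ (λ c → ∑-zero ⟪ bnd (length b +ⁿ length a) (N ∸ c) ⟫ (λ l →
    solve 3 (λ m p q → m :* (con 0ℚ :* p) :* q := con 0ℚ) refl
      (mult (zipWith _+ⁿ_ (z ∷ b ++ a) (c ∷ l)) (z ∷ b ++ a)) (δL (zipWith _+ⁿ_ a (drop (length b) l)) u) (δ (c +ⁿ sum l +ⁿ s) N))))))
∑-bnd-words (z ∷ b) a (y ∷ ys) u s N = begin
  _ ≡⟨ trans (∑-pairL (lowerWord (y ∷ ys)) (lowerWord u) _) (∑-lowerWord-∷ y ys _) ⟩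
  _ ≡⟨ ∑-cong (lowerLetter y) (λ (c , x₀) → trans
         (∑-cong (lowerWord ys) (λ (d , x) → ∑-cong (lowerWord u) (λ (e , y') → cong₂ (λ p k → p * δ (k +ⁿ s) N)
           (*-assoc (δ x₀ z) (δL x b) (δL y' a)) (ℕP.+-assoc c d e))))
         (sym (∑-pairL (lowerWord ys) (lowerWord u) _))) ⟩
  _ ≡⟨ ∑-bnd-step (pairL (lowerWord ys) (lowerWord u)) (λ ((d , x) , (e , y')) → δL x b * δL y' a)
         (λ ((d , x) , (e , y')) → d +ⁿ e) (length b +ⁿ length a) s _ (∑-bnd-words b a ys u s) z y N ⟩
  _ ≡⟨ ∑-cong ⟪ upTo (suc N) ⟫ (λ c → ∑-cong ⟪ bnd (length b +ⁿ length a) (N ∸ c) ⟫ (λ l → cong (_* δ (c +ⁿ sum l +ⁿ s) N)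
         (let ba = zipWith _+ⁿ_ (b ++ a) l
              p = δL (zipWith _+ⁿ_ b (take (length b) l)) ys
              q = δL (zipWith _+ⁿ_ a (drop (length b) l)) u in begin
         ari (z +ⁿ c) z * (δ (z +ⁿ c) y * (mult ba (b ++ a) * (p * q)))
           ≡⟨ solve 5 (λ r t m p q → r :* (t :* (m :* (p :* q))) := r :* m :* (t :* p :* q)) refl
                (ari (z +ⁿ c) z) (δ (z +ⁿ c) y) (mult ba (b ++ a)) p q ⟩
         ari (z +ⁿ c) z * mult ba (b ++ a) * (δ (z +ⁿ c) y * p * q)
           ≡⟨ cong (_* (δ (z +ⁿ c) y * p * q)) (sym (mult-∷ (z +ⁿ c) ba z (b ++ a))) ⟩
         _ ∎))) ⟩
  _ ≡⟨ sym (∑-bnd-suc (length b +ⁿ length a) N _) ⟩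
  _ ∎

-- One block as the transpose of the action on a letter

∑-monomial : (c : ℚ) (x : X) (f : X → ℚ) → ∑ ((c , x) ∷ []) f ≡ c * f x
∑-monomial c x f = trans (∑-∷ c x [] f) (trans (cong (c * f x +_) (∑-[] f)) (+-identityʳ (c * f x)))

∑-shL : (L M : Lin (List ℕ)) (f : List ℕ → ℚ) → ∑ (shL L M) f ≡ ∑ L (λ u → ∑ M (λ v → ∑ (sh u v) f))
∑-shL L M f = trans (∑-bindL L _ f) (∑-cong L (λ u → ∑-bindL M _ f))

∑-blockLeft : (b a : List ℕ) (c : ℕ) (l u : List ℕ) →
  ∑ (blockLeft (b , c , a) l) (λ v → δL v u) ≡
  sgn (length (zipWith _+ⁿ_ b (take (length b) l))) *
  ∑ ⟪ desh u ⟫ (λ (u₁ , u₂) → δL (zipWith _+ⁿ_ b (take (length b) l)) (reverse u₁) * δL (zipWith _+ⁿ_ a (drop (length b) l)) u₂)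
∑-blockLeft b a c l u = begin
  _ ≡⟨ ∑-shL (antipode x) ((1ℚ , y) ∷ []) _ ⟩
  _ ≡⟨ ∑-monomial (sgn (length x)) (reverse x) _ ⟩
  _ ≡⟨ cong (sgn (length x) *_) (begin
         _ ≡⟨ ∑-single y _ ⟩
         _ ≡⟨ ∑-sh (reverse x) y u ⟩
         _ ≡⟨ ∑-cong ⟪ desh u ⟫ (λ (u₁ , u₂) → cong (_* δL y u₂) (δL-reverse x u₁)) ⟩
         _ ∎) ⟩
  _ ∎
  where
  x = zipWith _+ⁿ_ b (take (length b) l)
  y = zipWith _+ⁿ_ a (drop (length b) l)

-- The pairing of u ▷ v_c with the word p.
actCoeff : List ℕ → ℕ → List ℕ → ℚ
actCoeff u c p = ∑ (act (fromList (map leaf u)) (leaf c)) (λ y → ∑ (expT y) (λ v → δL v p))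

-- The coefficient of u ⊗ v_c in the contribution of the block β.
blockSum : List ℕ → ℕ → Block → ℚ
blockSum u c β = ∑ ⟪ lsFor β ⟫ (λ l → blockCoef β l * (δ (blockRight β l) c * ∑ (blockLeft β l) (λ v → δL v u)))

-- For a marked index at least 1 the alternative of an empty tuple is already `bnd 0 N`; it is a
-- genuine exception only for a marked v_0.
lsFor-suc : ∀ b N a → lsFor (b , suc N , a) ≡ bnd (length b +ⁿ length a) N
lsFor-suc b N a with length b +ⁿ length a
... | zero = refl
... | suc r = refl

blockSum-suc : ∀ u s b c a → blockSum u (suc s) (b , c , a) ≡
  ∑ ⟪ desh u ⟫ (λ (u₁ , u₂) → ∑ (lowerWord u₁) (λ (d , x) → ∑ (lowerWord u₂) (λ (e , y) →
    sgn (length x) * (δL (reverse x) b * (δ (suc s +ⁿ (d +ⁿ e)) c * δL y a)))))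
blockSum-suc u s b zero a = trans
  (zeroSum b a)
  (sym (∑-zero ⟪ desh u ⟫ (λ (u₁ , u₂) → ∑-zero (lowerWord u₁) (λ (d , x) → ∑-zero (lowerWord u₂) (λ (e , y) →
    solve 3 (λ p q r → p :* (q :* (con 0ℚ :* r)) := con 0ℚ) refl (sgn (length x)) (δL (reverse x) b) (δL y a))))))
  where
  zeroSum : ∀ b a → blockSum u (suc s) (b , 0 , a) ≡ 0ℚ
  zeroSum [] [] = trans (∑-single [] _) (trans
    (cong (1ℚ *_) (*-zeroˡ (∑ (blockLeft ([] , 0 , []) []) (λ v → δL v u)))) (*-zeroʳ 1ℚ))
  zeroSum [] (k ∷ a) = ∑-[] _
  zeroSum (k ∷ b) a = ∑-[] _
blockSum-suc u s b (suc N) a = begin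
  _ ≡⟨ ∑-congˡ (cong ⟪_⟫ (lsFor-suc b N a)) ⟩
  _ ≡⟨ ∑-bnd-cong (length b +ⁿ length a) N (λ l len _ → begin
         M l * (δ (suc N ∸ sum l) (suc s) * ∑ (blockLeft (b , suc N , a) l) (λ v → δL v u))
           ≡⟨ cong₂ (λ p q → M l * (p * q)) (δ-drop l) (∑-blockLeft b a (suc N) l u) ⟩
         M l * (δ (sum l +ⁿ s) N * (sgn (length (x l)) * D l))
           -- `zipWith` would shorten a word against a short tuple; the known length of l makes the
           -- sign of the antipode independent of l.
           ≡⟨ cong (λ n → M l * (δ (sum l +ⁿ s) N * (sgn n * D l))) (length-x l len) ⟩
         M l * (δ (sum l +ⁿ s) N * (sgn (length b) * D l))
           ≡⟨ solve 4 (λ m t g d → m :* (t :* (g :* d)) := g :* m :* t :* d) refl (M l) (δ (sum l +ⁿ s) N) (sgn (length b)) (D l) ⟩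
         sgn (length b) * M l * δ (sum l +ⁿ s) N * D l
           ≡⟨ sym (∑-*ˡ ⟪ desh u ⟫ (sgn (length b) * M l * δ (sum l +ⁿ s) N) _) ⟩
         _ ∎) ⟩
  _ ≡⟨ ∑-swap ⟪ bnd (length b +ⁿ length a) N ⟫ ⟪ desh u ⟫ _ ⟩
  _ ≡⟨ ∑-cong ⟪ desh u ⟫ (λ (u₁ , u₂) → begin
         _ ≡⟨ ∑-cong ⟪ bnd (length b +ⁿ length a) N ⟫ (λ l →
                solve 5 (λ g m t p q → g :* m :* t :* (p :* q) := g :* (m :* (p :* q) :* t)) refl
                  (sgn (length b)) (M l) (δ (sum l +ⁿ s) N) (δL (x l) (reverse u₁)) (δL (y l) u₂)) ⟩
         _ ≡⟨ ∑-*ˡ ⟪ bnd (length b +ⁿ length a) N ⟫ (sgn (length b)) _ ⟩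
         _ ≡⟨ cong (sgn (length b) *_) (sym (∑-bnd-words b a (reverse u₁) u₂ s N)) ⟩
         _ ≡⟨ cong (sgn (length b) *_) (∑-pairL (lowerWord (reverse u₁)) (lowerWord u₂) _) ⟩
         _ ≡⟨ cong (sgn (length b) *_) (sym (∑-lowerWord-reverse u₁
                (λ d x → ∑ (lowerWord u₂) (λ (e , y) → δL x b * δL y a * δ (d +ⁿ e +ⁿ s) N)))) ⟩
         _ ≡⟨ sym (∑-*ˡ (lowerWord u₁) (sgn (length b)) _) ⟩
         _ ≡⟨ ∑-cong (lowerWord u₁) (λ (d , x) → trans (sym (∑-*ˡ (lowerWord u₂) (sgn (length b)) _))
                (∑-cong (lowerWord u₂) (λ (e , y) → begin
                  sgn (length b) * (δL (reverse x) b * δL y a * δ (d +ⁿ e +ⁿ s) N)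
                    ≡⟨ cong (λ k → sgn (length b) * (δL (reverse x) b * δL y a * δ k N)) (ℕP.+-comm (d +ⁿ e) s) ⟩
                  sgn (length b) * (δL (reverse x) b * δL y a * δ (s +ⁿ (d +ⁿ e)) N)
                    ≡⟨ solve 4 (λ g p q t → g :* (p :* q :* t) := g :* p :* (t :* q)) refl
                         (sgn (length b)) (δL (reverse x) b) (δL y a) (δ (s +ⁿ (d +ⁿ e)) N) ⟩
                  sgn (length b) * δL (reverse x) b * (δ (s +ⁿ (d +ⁿ e)) N * δL y a)
                    -- The sign depends on the word only, and the delta identifies b with
                    -- `reverse x`: the sign of the antipode becomes that of the iterated bracket.
                    ≡⟨ cong (_* (δ (s +ⁿ (d +ⁿ e)) N * δL y a)) (sym (δL-subst (reverse x) b (λ w → sgn (length w)))) ⟩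
                  sgn (length (reverse x)) * δL (reverse x) b * (δ (s +ⁿ (d +ⁿ e)) N * δL y a)
                    ≡⟨ cong (λ n → sgn n * δL (reverse x) b * (δ (s +ⁿ (d +ⁿ e)) N * δL y a)) (LP.length-reverse x) ⟩
                  sgn (length x) * δL (reverse x) b * (δ (s +ⁿ (d +ⁿ e)) N * δL y a)
                    ≡⟨ *-assoc (sgn (length x)) (δL (reverse x) b) _ ⟩
                  _ ∎))) ⟩
         _ ∎) ⟩
  _ ∎
  where
  M D : List ℕ → ℚ
  x y : List ℕ → List ℕ
  M l = mult (zipWith _+ⁿ_ (b ++ a) l) (b ++ a)
  x l = zipWith _+ⁿ_ b (take (length b) l)
  y l = zipWith _+ⁿ_ a (drop (length b) l)
  D l = ∑ ⟪ desh u ⟫ (λ (u₁ , u₂) → δL (x l) (reverse u₁) * δL (y l) u₂)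
  length-x : ∀ l → length l ≡ length b +ⁿ length a → length (x l) ≡ length b
  length-x l len = begin
    length (x l)
      ≡⟨ LP.length-zipWith _+ⁿ_ b (take (length b) l) ⟩
    length b ℕ.⊓ length (take (length b) l)
      ≡⟨ cong (length b ℕ.⊓_) (trans (LP.length-take (length b) l) (cong (length b ℕ.⊓_) len)) ⟩
    length b ℕ.⊓ (length b ℕ.⊓ (length b +ⁿ length a))
      ≡⟨ cong (length b ℕ.⊓_) (ℕP.m≤n⇒m⊓n≡m (ℕP.m≤m+n (length b) (length a))) ⟩
    length b ℕ.⊓ length b
      ≡⟨ ℕP.⊓-idem (length b) ⟩
    length b ∎
  δ-drop : ∀ l → δ (suc N ∸ sum l) (suc s) ≡ δ (sum l +ⁿ s) N
  -- A truncated difference with positive value is a true difference, hence the equivalence.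
  δ-drop l = δ-cong {suc N ∸ sum l} {suc s} {sum l +ⁿ s} {N}
    (λ e → ℕP.suc-injective (trans (sym (ℕP.+-suc (sum l) s)) (trans (cong (sum l +ⁿ_) (sym e))
      (ℕP.m+[n∸m]≡n {sum l} (ℕP.<⇒≤ (ℕP.m∸n≢0⇒n<m (λ z → ℕP.0≢1+n (trans (sym z) e))))))))
    (λ e → trans (cong (λ k → suc k ∸ sum l) (sym e))
      (trans (cong (_∸ sum l) (sym (ℕP.+-suc (sum l) s))) (ℕP.m+n∸m≡n (sum l) (suc s))))

actCoeff-suc : ∀ u s p → actCoeff u (suc s) p ≡ ∑ ⟪ marks p ⟫ (blockSum u (suc s))
actCoeff-suc u s p = begin
  _ ≡⟨ ∑-act-word u s _ ⟩
  _ ≡⟨ ∑-cong (lowerWord u) (λ (d , l) → ∑-cong ⟪ desh l ⟫ (λ (x , y) → begin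
         sgn (length x) * δL (x ʳ++ (suc s +ⁿ d) ∷ y) p
           ≡⟨ cong (λ w → sgn (length x) * δL w p) (LP.ʳ++-defn x) ⟩
         sgn (length x) * δL (reverse x ++ (suc s +ⁿ d) ∷ y) p
           ≡⟨ cong (sgn (length x) *_) (δL-marks (reverse x) (suc s +ⁿ d) y p) ⟩
         _ ≡⟨ sym (∑-*ˡ ⟪ marks p ⟫ (sgn (length x)) _) ⟩
         _ ∎)) ⟩
  _ ≡⟨ ∑-lowerWord-desh u (λ d x y → ∑ ⟪ marks p ⟫ (λ (b , c , a) →
         sgn (length x) * (δL (reverse x) b * (δ (suc s +ⁿ d) c * δL y a)))) ⟩
  _ ≡⟨ ∑-cong ⟪ desh u ⟫ (λ (u₁ , u₂) → trans
         (∑-cong (lowerWord u₁) (λ (d , x) → ∑-swap (lowerWord u₂) ⟪ marks p ⟫ _))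
         (∑-swap (lowerWord u₁) ⟪ marks p ⟫ _)) ⟩
  _ ≡⟨ ∑-swap ⟪ desh u ⟫ ⟪ marks p ⟫ _ ⟩
  _ ≡⟨ ∑-cong ⟪ marks p ⟫ (λ (b , c , a) → sym (blockSum-suc u s b c a)) ⟩
  _ ∎

-- For a marked index c ≥ 1 the bound |l| ≤ c - 1 keeps the output index positive, and a marked v_0
-- admits only the empty tuple. So v_0 on the right comes only from the block v_0 alone, which
-- mirrors t ▷ v_0 = 0.
blockSum-zero : ∀ u b c a → blockSum u 0 (b , c , a) ≡ δL u [] * (δL [] b * (δ 0 c * δL [] a))
blockSum-zero u b (suc N) a = begin
  _ ≡⟨ ∑-congˡ (cong ⟪_⟫ (lsFor-suc b N a)) ⟩
  _ ≡⟨ ∑-bnd-cong (length b +ⁿ length a) N {g = λ _ → 0ℚ} (λ l _ l≤ → trans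
         (cong (λ z → blockCoef β l * (z * ∑ (blockLeft β l) (λ v → δL v u)))
           (δ-≢ {suc N ∸ sum l} {0} (λ e → ℕP.<⇒≱ (s≤s l≤) (ℕP.m∸n≡0⇒m≤n e))))
         (solve 2 (λ p q → p :* (con 0ℚ :* q) := con 0ℚ) refl (blockCoef β l) (∑ (blockLeft β l) (λ v → δL v u)))) ⟩
  _ ≡⟨ ∑-0 ⟪ bnd (length b +ⁿ length a) N ⟫ ⟩
  0ℚ ≡⟨ solve 3 (λ p q r → con 0ℚ := p :* (q :* (con 0ℚ :* r))) refl (δL u []) (δL [] b) (δL [] a) ⟩
  _ ∎
  where
  β : Block
  β = b , suc N , a
blockSum-zero u [] zero [] = trans (∑-single [] _) (begin
  1ℚ * (1ℚ * ∑ (blockLeft ([] , 0 , []) []) (λ v → δL v u))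
    ≡⟨ cong (λ z → 1ℚ * (1ℚ * z)) (trans (∑-shL (antipode []) ((1ℚ , []) ∷ []) _)
         (trans (∑-single [] _) (trans (∑-single [] _) (∑-single [] _)))) ⟩
  1ℚ * (1ℚ * δL [] u)
    ≡⟨ cong (λ z → 1ℚ * (1ℚ * z)) (δL-sym [] u) ⟩
  1ℚ * (1ℚ * δL u [])
    ≡⟨ solve 1 (λ p → con 1ℚ :* (con 1ℚ :* p) := p :* (con 1ℚ :* (con 1ℚ :* con 1ℚ))) refl (δL u []) ⟩
  _ ∎)
blockSum-zero u [] zero (k ∷ a) = trans (∑-[] _)
  (solve 1 (λ p → con 0ℚ := p :* (con 1ℚ :* (con 1ℚ :* con 0ℚ))) refl (δL u []))
blockSum-zero u (k ∷ b) zero a = trans (∑-[] _)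
  (solve 2 (λ p q → con 0ℚ := p :* (con 0ℚ :* q)) refl (δL u []) (δ 0 0 * δL [] a))

actCoeff-zero : ∀ u p → actCoeff u 0 p ≡ ∑ ⟪ marks p ⟫ (blockSum u 0)
actCoeff-zero u p = begin
  actCoeff u 0 p
    ≡⟨ ε u ⟩
  δL u [] * δL (0 ∷ []) p
    ≡⟨ cong (δL u [] *_) (δL-marks [] 0 [] p) ⟩
  _ ≡⟨ sym (∑-*ˡ ⟪ marks p ⟫ (δL u []) _) ⟩
  _ ≡⟨ ∑-cong ⟪ marks p ⟫ (λ (b , c , a) → sym (blockSum-zero u b c a)) ⟩
  _ ∎
  where
  ε : ∀ u → actCoeff u 0 p ≡ δL u [] * δL (0 ∷ []) p
  ε [] = trans (∑-single (leaf 0) _) (trans (∑-single (0 ∷ []) _) (sym (*-identityˡ (δL (0 ∷ []) p))))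
  ε (k ∷ u) = trans (∑-act-zero (leaf k) (fromList (map leaf u)) _) (sym (*-zeroˡ (δL (0 ∷ []) p)))

actCoeff-blocks : ∀ u c p → actCoeff u c p ≡ ∑ ⟪ marks p ⟫ (blockSum u c)
actCoeff-blocks u zero p = actCoeff-zero u p
actCoeff-blocks u (suc s) p = actCoeff-suc u s p

-- Decomposition into blocks

∑-blocksRHS-∷ : (β : Block) (βs : List Block) (f : List ℕ × List ℕ → ℚ) →
  ∑ (blocksRHS (β ∷ βs)) f ≡
  ∑ ⟪ lsFor β ⟫ (λ l → blockCoef β l * ∑ (blockLeft β l) (λ x → ∑ (blocksRHS βs) (λ (v , w) →
    ∑ (sh x v) (λ z → f (z , blockRight β l ∷ w)))))
∑-blocksRHS-∷ β βs f = trans (∑-concatMap _ (lsFor β) f) (∑-cong ⟪ lsFor β ⟫ (λ l →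
  trans (∑-scaleL (blockCoef β l) _ f) (cong (blockCoef β l *_)
    (trans (∑-bindL (blockLeft β l) _ f) (∑-cong (blockLeft β l) (λ x →
      trans (∑-bindL (blocksRHS βs) _ f) (∑-cong (blocksRHS βs) (λ p → ∑-mapL _ (sh x (proj₁ p)) f))))))))

blocksCoeff : List ℕ → List ℕ → List Block → ℚ
blocksCoeff u w βs = ∑ (blocksRHS βs) (λ (v , w') → δL v u * δL w' w)

-- The left factor of β is shuffled into those of the later blocks, so by duality u is distributed
-- over the two; the output of β is the first letter on the right.
blocksCoeff-∷ : ∀ u c w β βs →
  blocksCoeff u (c ∷ w) (β ∷ βs) ≡ ∑ ⟪ desh u ⟫ (λ (u₁ , u₂) → blockSum u₁ c β * blocksCoeff u₂ w βs)
blocksCoeff-∷ u c w β βs = begin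
  _ ≡⟨ ∑-blocksRHS-∷ β βs _ ⟩
  _ ≡⟨ ∑-cong ⟪ lsFor β ⟫ (λ l → trans (cong (blockCoef β l *_) (inner l)) (sym (∑-*ˡ ⟪ desh u ⟫ (blockCoef β l) _))) ⟩
  _ ≡⟨ ∑-swap ⟪ lsFor β ⟫ ⟪ desh u ⟫ _ ⟩
  _ ≡⟨ ∑-cong ⟪ desh u ⟫ (λ (u₁ , u₂) → trans
         (∑-cong ⟪ lsFor β ⟫ (λ l → sym (*-assoc (blockCoef β l)
           (δ (blockRight β l) c * ∑ (blockLeft β l) (λ x → δL x u₁)) (blocksCoeff u₂ w βs))))
         (∑-*ʳ ⟪ lsFor β ⟫ (blocksCoeff u₂ w βs) _)) ⟩
  _ ∎
  where
  inner : ∀ l →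
    ∑ (blockLeft β l) (λ x → ∑ (blocksRHS βs) (λ (v , w') → ∑ (sh x v) (λ z → δL z u * (δ (blockRight β l) c * δL w' w)))) ≡
    ∑ ⟪ desh u ⟫ (λ (u₁ , u₂) → δ (blockRight β l) c * ∑ (blockLeft β l) (λ x → δL x u₁) * blocksCoeff u₂ w βs)
  inner l = begin
    _ ≡⟨ ∑-cong (blockLeft β l) (λ x → ∑-cong (blocksRHS βs) (λ (v , w') → begin
           _ ≡⟨ ∑-*ʳ (sh x v) (k * δL w' w) _ ⟩
           _ ≡⟨ cong (_* (k * δL w' w)) (∑-sh x v u) ⟩
           _ ≡⟨ sym (∑-*ʳ ⟪ desh u ⟫ (k * δL w' w) _) ⟩
           _ ≡⟨ ∑-cong ⟪ desh u ⟫ (λ (u₁ , u₂) → solve 4 (λ p q k r → p :* q :* (k :* r) := k :* p :* (q :* r)) refl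
                  (δL x u₁) (δL v u₂) k (δL w' w)) ⟩
           _ ∎)) ⟩
    _ ≡⟨ ∑-cong (blockLeft β l) (λ x → ∑-swap (blocksRHS βs) ⟪ desh u ⟫ _) ⟩
    _ ≡⟨ ∑-swap (blockLeft β l) ⟪ desh u ⟫ _ ⟩
    _ ≡⟨ ∑-cong ⟪ desh u ⟫ (λ (u₁ , u₂) → trans
           (∑-product (blockLeft β l) (blocksRHS βs) (λ x → k * δL x u₁) (λ (v , w') → δL v u₂ * δL w' w))
           (cong (_* blocksCoeff u₂ w βs) (∑-*ˡ (blockLeft β l) k _))) ⟩
    _ ∎
    where
    k : ℚ
    k = δ (blockRight β l) c

markedSum : List ℕ → List ℕ → List ℕ → ℚ
markedSum u w r = ∑ ⟪ markedBlocks r ⟫ (blocksCoeff u w)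

markedSum-[] : ∀ u r → markedSum u [] r ≡ δL [] u * δL [] r
markedSum-[] u [] = trans (∑-single [] _) (∑-single ([] , []) _)
markedSum-[] u (x ∷ xs) = trans (∑-goBefore [] (x ∷ xs) _) (trans
  (∑-zero ⟪ prefixes (x ∷ xs) ⟫ (λ (p , r) → ∑-zero ⟪ marks p ⟫ (λ β → ∑-zero ⟪ markedBlocks r ⟫ (λ βs →
    trans (∑-blocksRHS-∷ β βs _) (∑-zero ⟪ lsFor β ⟫ (λ l → trans
      (cong (blockCoef β l *_) (∑-zero (blockLeft β l) (λ y → ∑-zero (blocksRHS βs) (λ (v , w') →
        ∑-zero (sh y v) (λ z → *-zeroʳ (δL z u))))))
      (*-zeroʳ (blockCoef β l))))))))
  (sym (*-zeroʳ (δL [] u))))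

-- The transpose of A ▷ bB = (A₍₁₎ ▷ b)(A₍₂₎ ▷ B): the first block is the prefix of r produced by
-- the action on the first letter c.
markedSum-∷ : ∀ u c w r → markedSum u (c ∷ w) r ≡
  ∑ ⟪ desh u ⟫ (λ (u₁ , u₂) → ∑ ⟪ prefixes r ⟫ (λ (p , r') → actCoeff u₁ c p * markedSum u₂ w r'))
markedSum-∷ u c w r = begin
  _ ≡⟨ firstBlock r ⟩
  _ ≡⟨ ∑-cong ⟪ prefixes r ⟫ (λ (p , r') → begin
         _ ≡⟨ ∑-cong ⟪ marks p ⟫ (λ β → trans (∑-cong ⟪ markedBlocks r' ⟫ (blocksCoeff-∷ u c w β))
                (∑-swap ⟪ markedBlocks r' ⟫ ⟪ desh u ⟫ _)) ⟩
         _ ≡⟨ ∑-swap ⟪ marks p ⟫ ⟪ desh u ⟫ _ ⟩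
         _ ≡⟨ ∑-cong ⟪ desh u ⟫ (λ (u₁ , u₂) → trans
                (∑-product ⟪ marks p ⟫ ⟪ markedBlocks r' ⟫ (blockSum u₁ c) (blocksCoeff u₂ w))
                (cong (_* markedSum u₂ w r') (sym (actCoeff-blocks u₁ c p)))) ⟩
         _ ∎) ⟩
  _ ≡⟨ ∑-swap ⟪ prefixes r ⟫ ⟪ desh u ⟫ _ ⟩
  _ ∎
  where
  firstBlock : ∀ r → markedSum u (c ∷ w) r ≡
    ∑ ⟪ prefixes r ⟫ (λ (p , r') → ∑ ⟪ marks p ⟫ (λ β → ∑ ⟪ markedBlocks r' ⟫ (λ βs → blocksCoeff u (c ∷ w) (β ∷ βs))))
  firstBlock [] = trans (trans (∑-single [] _) (trans (∑-single ([] , []) _) (*-zeroʳ (δL [] u))))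
    (sym (trans (∑-single ([] , []) _) (∑-[] _)))
  firstBlock (x ∷ xs) = ∑-goBefore [] (x ∷ xs) _

-- The clauses of `triW` inspect the first word as well, so the unfolding computes only after a case
-- distinction on it.
triW-∷ : ∀ u c w → triW u (c ∷ w) ≡
  concatMap (λ p → mulL (bindL (act (fromList (map leaf (proj₁ p))) (leaf c)) expT) (triW (proj₂ p) w)) (desh u)
triW-∷ [] c w = refl
triW-∷ (x ∷ u) c w = refl

∑-triW : ∀ u w r → ∑ (triW u w) (λ v → δL v r) ≡ markedSum u w r
∑-triW [] [] r = trans (∑-single [] _) (sym (trans (markedSum-[] [] r) (*-identityˡ (δL [] r))))
∑-triW (x ∷ u) [] r = trans (∑-[] _) (sym (trans (markedSum-[] (x ∷ u) r) (*-zeroˡ (δL [] r))))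
∑-triW u (c ∷ w) r = begin
  _ ≡⟨ ∑-congˡ (triW-∷ u c w) ⟩
  _ ≡⟨ ∑-concatMap _ (desh u) _ ⟩
  _ ≡⟨ ∑-cong ⟪ desh u ⟫ (λ (u₁ , u₂) → trans
         (∑-mulL-δL (bindL (act (fromList (map leaf u₁)) (leaf c)) expT) (triW u₂ w) r)
         (∑-cong ⟪ prefixes r ⟫ (λ (p , r') → cong₂ _*_
           (∑-bindL (act (fromList (map leaf u₁)) (leaf c)) expT _) (∑-triW u₂ w r')))) ⟩
  _ ≡⟨ sym (markedSum-∷ u c w r) ⟩
  _ ∎

-- The unmarked initial segment, up to i_1, is what A₍₁₎ contributes to A₍₁₎(A₍₂₎ ▷ B). Cutting it
-- off dualises that product, and shuffling it with the left factors of the blocks dualises the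
-- coproduct of A.
theorem4p25 : (k u w : List ℕ) → Δa-coeff k u w ≡ coeff2 (ariRHS k) (u , w)
theorem4p25 k u w = begin
  coeff (gl u w) k
    ≡⟨ coeff-∑ (gl u w) k ⟩
  _ ≡⟨ ∑-concatMap _ (desh u) _ ⟩
  _ ≡⟨ ∑-cong ⟪ desh u ⟫ (λ (u₁ , u₂) → trans
         (∑-mulL-δL ((1ℚ , u₁) ∷ []) (triW u₂ w) k)
         (∑-cong ⟪ prefixes k ⟫ (λ (p , r) → cong₂ _*_
           (trans (∑-single u₁ _) (δL-sym u₁ p)) (∑-triW u₂ w r)))) ⟩
  ∑ ⟪ desh u ⟫ (λ (u₁ , u₂) → ∑ ⟪ prefixes k ⟫ (λ (p , r) → δL p u₁ * markedSum u₂ w r))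
    ≡⟨ ∑-swap ⟪ desh u ⟫ ⟪ prefixes k ⟫ _ ⟩
  _ ≡⟨ ∑-cong ⟪ prefixes k ⟫ (λ (p , r) → sym (prefixTerm p r)) ⟩
  _ ≡⟨ sym (∑-concatMap _ (prefixes k) _) ⟩
  ∑ (ariRHS k) (λ (x , y) → δL x u * δL y w)
    ≡⟨ sym (coeff2-∑ (ariRHS k) u w) ⟩
  coeff2 (ariRHS k) (u , w) ∎
  where
  prefixTerm : ∀ p r →
    ∑ (concatMap (λ βs → bindL (blocksRHS βs) (λ q → mapL (λ z → z , proj₂ q) (sh p (proj₁ q)))) (markedBlocks r))
      (λ (x , y) → δL x u * δL y w) ≡
    ∑ ⟪ desh u ⟫ (λ (u₁ , u₂) → δL p u₁ * markedSum u₂ w r)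
  prefixTerm p r = begin
    _ ≡⟨ ∑-concatMap _ (markedBlocks r) _ ⟩
    _ ≡⟨ ∑-cong ⟪ markedBlocks r ⟫ (λ βs → begin
           _ ≡⟨ ∑-bindL (blocksRHS βs) _ _ ⟩
           _ ≡⟨ ∑-cong (blocksRHS βs) (λ (v , y) → begin
                  _ ≡⟨ ∑-mapL _ (sh p v) _ ⟩
                  _ ≡⟨ ∑-*ʳ (sh p v) (δL y w) _ ⟩
                  _ ≡⟨ cong (_* δL y w) (∑-sh p v u) ⟩
                  _ ≡⟨ sym (∑-*ʳ ⟪ desh u ⟫ (δL y w) _) ⟩
                  _ ≡⟨ ∑-cong ⟪ desh u ⟫ (λ (u₁ , u₂) → *-assoc (δL p u₁) (δL v u₂) (δL y w)) ⟩
                  _ ∎) ⟩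
           _ ≡⟨ ∑-swap (blocksRHS βs) ⟪ desh u ⟫ _ ⟩
           _ ≡⟨ ∑-cong ⟪ desh u ⟫ (λ (u₁ , u₂) → ∑-*ˡ (blocksRHS βs) (δL p u₁) _) ⟩
           _ ∎) ⟩
    _ ≡⟨ ∑-swap ⟪ markedBlocks r ⟫ ⟪ desh u ⟫ _ ⟩
    _ ≡⟨ ∑-cong ⟪ desh u ⟫ (λ (u₁ , u₂) → ∑-*ˡ ⟪ markedBlocks r ⟫ (δL p u₁) (blocksCoeff u₂ w)) ⟩
    _ ∎
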